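{- For every integer $n\geq 0$, \[ \bar{p}(40n+35)\equiv 0 \pmod{5}. \]
   Context: An overpartition of a positive integer $n$ is a partition of $n$ (a nonincreasing sequence of positive integers summing to $n$) in which the first occurrence of each distinct part may be overlined. For $n\geq 1$, $\bar{p}(n)$ denotes the number of overpartitions of $n$, and $\bar{p}(0)=1$. -}

module Defs where

open import Data.Nat using (ℕ; _+_; _≤_; _<_)
open import Data.Bool using (Bool; true)
open import Data.Product using (_×_; _,_)
open import Data.List using (List; []; _∷_; map; sum)
open import Data.List.Membership.Propositional using (_∈_)
open import Data.List.Relation.Unary.Unique.Propositional using (Unique)
open import Relation.Binary.PropositionalEquality using (_≡_)
open import Function.Bundles using (_⇔_)

-- An overpartition is written as a list of (part , overlined?) entries,
-- read left to right in nonincreasing order of parts.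
-- 'Chain' says: parts are positive and nonincreasing, and an entry may be
-- overlined only if it is the first occurrence of its part, i.e. its
-- predecessor (if any) is a strictly larger part.
data Chain : List (ℕ × Bool) → Set where
  nil  : Chain []
  one  : ∀ {a b} → 1 ≤ a → Chain ((a , b) ∷ [])
  cons : ∀ {a b c d rest} →
         c ≤ a →
         (d ≡ true → c < a) →
         Chain ((c , d) ∷ rest) →
         Chain ((a , b) ∷ (c , d) ∷ rest)

size : List (ℕ × Bool) → ℕ
size [] = 0
size ((a , _) ∷ xs) = a + size xs

IsOverpartition : ℕ → List (ℕ × Bool) → Set
IsOverpartition m x = Chain x × size x ≡ m

-- L is a duplicate-free list containing exactly the overpartitions of m;
-- hence length L = p̄(m).
Enumerates : ℕ → List (List (ℕ × Bool)) → Set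
Enumerates m L = Unique L × (∀ x → (x ∈ L) ⇔ IsOverpartition m x)

{-# OPTIONS --safe #-}
module Submission where

-- Let P̄(q) = Σ p̄(n) q^n and φ(q) = Σ_{k∈ℤ} q^{k²}. Gauss' identity says P̄(q) φ(-q) = 1, so modulo 5
--   P̄(q) = φ(-q)⁴ / φ(-q)⁵ ≡ φ(-q)⁴ / φ(-q⁵).
-- The coefficients r₄(n) of φ(q)⁴ satisfy r₄(5n) + 5 r₄(n/5) = 6 r₄(n), by counting the factorisations of
-- integral quaternions of norm 5n with right factor one of 1 ± 2i, 1 ± 2j, 1 ± 2k; hence r₄(5n) ≡ r₄(n).
-- Extracting the exponents divisible by 5 therefore gives
--   Σ p̄(5n) q^n ≡ φ(-q)⁴ / φ(-q) = φ(-q)³,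
-- that is p̄(5n) ≡ (-1)^n r₃(n), and r₃(8n + 7) = 0 because squares are 0, 1 or 4 modulo 8.

open import Defs
open import Data.Nat using (ℕ; zero; suc; z≤n; s≤s; _+_; _*_; _^_; _≤_; _<_; _≤?_; _≟_)
open import Data.Nat.Divisibility using (_∣_; m%n≡0⇒n∣m)
open import Data.Bool using (Bool; true; false; if_then_else_)
open import Data.Product using (_×_; _,_; ∃; ∃₂; proj₁; proj₂)
open import Data.List using (List; []; _∷_; _++_; map; length; filter; cartesianProduct)

open import Algebra using (CommutativeSemiring)
import Algebra.Properties.CommutativeSemigroup as CommutativeSemigroupProperties
import Algebra.Properties.CommutativeSemiring.Exp as CommutativeExp
import Algebra.Properties.Semiring.Exp as Exp
import Algebra.Solver.Ring.NaturalCoefficients.Default as SemiringSolver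
open import Data.Empty using (⊥-elim)
open import Data.Fin using (Fin; toℕ; fromℕ<)
import Data.Fin.Properties as Finₚ
open import Data.Integer using (ℤ; +_; -[1+_]; ∣_∣; -_)
  renaming (_+_ to _+ᶻ_; _*_ to _*ᶻ_; _-_ to _-ᶻ_)
open import Data.Integer.DivMod using (_/ℕ_; n%ℕd<d; a≡a%ℕn+[a/ℕn]*n)
open import Data.Integer.Divisibility.Signed using (divides; _∣?_; ∣m∣n⇒∣m+n; ∣m+n∣n⇒∣m; ∣m⇒∣m*n; ∣-refl)
  renaming (_∣_ to _∣ᶻ_)
import Data.Integer.Properties as ℤₚ
import Data.Integer.Solver as ℤSolver
open import Data.List.Membership.Propositional using (_∈_)
open import Data.List.Membership.Propositional.Properties
  using (∈-++⁺ˡ; ∈-++⁺ʳ; ∈-++⁻; ∈-map⁺; ∈-map⁻; ∈-filter⁺; ∈-filter⁻;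
         ∈-cartesianProduct⁺; ∈-cartesianProduct⁻)
open import Data.List.Membership.Propositional.Properties.WithK using (unique∧set⇒bag)
open import Data.List.Properties using (∷-injectiveʳ; length-++; length-map)
open import Data.List.Relation.Binary.BagAndSetEquality using (∼bag⇒↭)
open import Data.List.Relation.Binary.Permutation.Propositional.Properties using (↭-length)
open import Data.List.Relation.Unary.All as All using (All; []; _∷_)
open import Data.List.Relation.Unary.AllPairs using ([]; _∷_)
open import Data.List.Relation.Unary.Any using (here; there)
open import Data.List.Relation.Unary.Unique.Propositional using (Unique)
import Data.List.Relation.Unary.Unique.Propositional.Properties as Uniqueₚ
open import Data.Nat.DivMod
  using (_%_; %-distribˡ-+; %-distribˡ-*; [m+kn]%n≡m%n; m%n<n; m%n%n≡m%n; m*n%n≡0)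
open import Data.Nat.Induction using (<-rec)
open import Data.Nat.ListAction using (sum)
import Data.Nat.Properties as ℕₚ
import Data.Nat.Solver as ℕSolver
open import Data.Sum using (_⊎_; inj₁; inj₂; [_,_]′)
open import Data.Unit using (⊤; tt)
open import Function using (_⇔_; mk⇔; _∘_; Equivalence)
import Function.Properties.Equivalence as ⇔
open import Level using (0ℓ)
import Relation.Binary.Reasoning.Setoid as SetoidReasoning
open import Relation.Binary.PropositionalEquality as ≡ using (_≡_; refl)
open import Relation.Binary.Structures using (IsEquivalence)
open import Relation.Nullary using (¬_; yes; no; does; _×-dec_; _→-dec_)
open import Relation.Nullary.Decidable using (from-yes; does-⇔; ¬?)
open import Relation.Unary using (Decidable)

open Equivalence using (to; from)

-- Power series over a commutative semiring

-- Coefficients are natural numbers taken modulo 5, a semiring in which 4 serves as -1. Quotients of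
-- series are not formed: an identity is multiplied through, and a factor with constant term 1 is
-- cancelled by `⊛-cancelˡ`. Gauss' identity relates an infinite product and an infinite sum. Its
-- coefficient at q^m depends only on parts and squares up to m, so an exact finite identity at each
-- level N suffices, namely `Z-Θ`, whose error terms start at q^(N+1). The extra variable x of `Z`
-- makes an induction on N possible: the step replaces x by xq. The number six has a geometric
-- origin. Modulo 5 the integral quaternions become the 2×2 matrices over F₅, with the norm as
-- determinant. A nonzero v of norm 0 has rank 1, and its right factor of norm 5 is fixed by the
-- kernel of v, one of the 6 lines of F₅²; a zero v admits all six. As 6 = 1 modulo 5, both kinds of
-- v contribute 1 to the count.

module PowerSeries {c ℓ} (R : CommutativeSemiring c ℓ) where
  private module R = CommutativeSemiring R
  open R using (0#; 1#) renaming (Carrier to K; _≈_ to _≈ᴷ_; _+_ to _+ᴷ_; _*_ to _*ᴷ_)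
  open SemiringSolver R using (solve; _:=_; _:+_; _:*_; con)
  open SetoidReasoning R.setoid

  Series : Set c
  Series = ℕ → K

  infix 4 _≗_ _≋_
  _≗_ : Series → Series → Set ℓ
  f ≗ g = ∀ n → f n ≈ᴷ g n

  -- A record, so that the two sides can be inferred from the type.
  record _≋_ (f g : Series) : Set ℓ where
    constructor pointwise
    field coeff : f ≗ g
  open _≋_ public

  tail : Series → Series
  tail f n = f (suc n)

  const : K → Series
  const a zero    = a
  const a (suc n) = 0#

  infixl 6 _⊕_
  infixl 7 _⊛_
  _⊕_ : Series → Series → Series
  (f ⊕ g) n = f n +ᴷ g n

  -- The Cauchy product by way of f = f(0) + q·tail f. There are no finite sums to manage, and
  -- products with a monomial or with a series in q⁵ reduce by computation.
  _⊛_ : Series → Series → Series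
  (f ⊛ g) zero    = f 0 *ᴷ g 0
  (f ⊛ g) (suc n) = f 0 *ᴷ g (suc n) +ᴷ (tail f ⊛ g) n

  ⊛-cong≤ : ∀ n {f f′ g g′} → (∀ i → i ≤ n → f i ≈ᴷ f′ i) → (∀ i → i ≤ n → g i ≈ᴷ g′ i) →
            (f ⊛ g) n ≈ᴷ (f′ ⊛ g′) n
  ⊛-cong≤ zero    p q = R.*-cong (p 0 z≤n) (q 0 z≤n)
  ⊛-cong≤ (suc n) p q = R.+-cong (R.*-cong (p 0 z≤n) (q (suc n) ℕₚ.≤-refl))
    (⊛-cong≤ n (λ i i≤n → p (suc i) (s≤s i≤n)) (λ i i≤n → q i (ℕₚ.m≤n⇒m≤1+n i≤n)))

  ⊛-cong : ∀ {f f′ g g′} → f ≗ f′ → g ≗ g′ → f ⊛ g ≗ f′ ⊛ g′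
  ⊛-cong p q n = ⊛-cong≤ n (λ i _ → p i) (λ i _ → q i)

  -- Stated for every `f` that vanishes beyond its constant term, because the induction passes to
  -- `tail f`, and the tail of `const a` is zero only pointwise, not literally a `const`.
  const-⊛ : ∀ a f g → (∀ n → f (suc n) ≈ᴷ 0#) → f 0 ≈ᴷ a → ∀ n → (f ⊛ g) n ≈ᴷ a *ᴷ g n
  const-⊛ a f g z p zero    = R.*-congʳ p
  const-⊛ a f g z p (suc n) = begin
    f 0 *ᴷ g (suc n) +ᴷ (tail f ⊛ g) n
      ≈⟨ R.+-cong (R.*-congʳ p) (const-⊛ 0# (tail f) g (λ m → z (suc m)) (z 0) n) ⟩
    a *ᴷ g (suc n) +ᴷ 0# *ᴷ g n
      ≈⟨ solve 3 (λ a x y → a :* x :+ con 0 :* y := a :* x) R.refl a (g (suc n)) (g n) ⟩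
    a *ᴷ g (suc n) ∎

  ⊛-distribʳ : ∀ h f g → (f ⊕ g) ⊛ h ≗ f ⊛ h ⊕ g ⊛ h
  ⊛-distribʳ h f g zero    = R.distribʳ _ _ _
  ⊛-distribʳ h f g (suc n) = begin
    (f 0 +ᴷ g 0) *ᴷ h (suc n) +ᴷ ((tail f ⊕ tail g) ⊛ h) n
      ≈⟨ R.+-congˡ (⊛-distribʳ h (tail f) (tail g) n) ⟩
    (f 0 +ᴷ g 0) *ᴷ h (suc n) +ᴷ ((tail f ⊛ h) n +ᴷ (tail g ⊛ h) n)
      ≈⟨ solve 5 (λ a b x u v → (a :+ b) :* x :+ (u :+ v) := (a :* x :+ u) :+ (b :* x :+ v)) R.refl _ _ _ _ _ ⟩
    (f ⊛ h ⊕ g ⊛ h) (suc n) ∎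

  -- The definition of `⊛` peels its left factor; this mirror image peels the right one, and the two
  -- recursions together give commutativity.
  ⊛-tailʳ : ∀ f g n → (f ⊛ g) (suc n) ≈ᴷ f (suc n) *ᴷ g 0 +ᴷ (f ⊛ tail g) n
  ⊛-tailʳ f g zero    = R.+-comm _ _
  ⊛-tailʳ f g (suc n) = begin
    f 0 *ᴷ g (suc (suc n)) +ᴷ (tail f ⊛ g) (suc n)
      ≈⟨ R.+-congˡ (⊛-tailʳ (tail f) g n) ⟩
    f 0 *ᴷ g (suc (suc n)) +ᴷ (f (suc (suc n)) *ᴷ g 0 +ᴷ (tail f ⊛ tail g) n)
      ≈⟨ solve 3 (λ a b c → a :+ (b :+ c) := b :+ (a :+ c)) R.refl _ _ _ ⟩
    f (suc (suc n)) *ᴷ g 0 +ᴷ (f ⊛ tail g) (suc n) ∎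

  ⊛-comm : ∀ f g → f ⊛ g ≗ g ⊛ f
  ⊛-comm f g zero    = R.*-comm _ _
  ⊛-comm f g (suc n) = begin
    f 0 *ᴷ g (suc n) +ᴷ (tail f ⊛ g) n ≈⟨ R.+-cong (R.*-comm _ _) (⊛-comm (tail f) g n) ⟩
    g (suc n) *ᴷ f 0 +ᴷ (g ⊛ tail f) n ≈⟨ ⊛-tailʳ g f n ⟨
    (g ⊛ f) (suc n)                    ∎

  scale-⊛ : ∀ a f g n → ((λ i → a *ᴷ f i) ⊛ g) n ≈ᴷ a *ᴷ (f ⊛ g) n
  scale-⊛ a f g zero    = R.*-assoc _ _ _
  scale-⊛ a f g (suc n) = begin
    a *ᴷ f 0 *ᴷ g (suc n) +ᴷ ((λ i → a *ᴷ tail f i) ⊛ g) n ≈⟨ R.+-cong (R.*-assoc _ _ _) (scale-⊛ a (tail f) g n) ⟩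
    a *ᴷ (f 0 *ᴷ g (suc n)) +ᴷ a *ᴷ (tail f ⊛ g) n         ≈⟨ R.distribˡ _ _ _ ⟨
    a *ᴷ (f ⊛ g) (suc n)                                   ∎

  ⊛-assoc : ∀ f g h → (f ⊛ g) ⊛ h ≗ f ⊛ (g ⊛ h)
  ⊛-assoc f g h zero    = R.*-assoc _ _ _
  ⊛-assoc f g h (suc n) = begin
    f 0 *ᴷ g 0 *ᴷ h (suc n) +ᴷ (((λ i → f 0 *ᴷ tail g i) ⊕ tail f ⊛ g) ⊛ h) n
      ≈⟨ R.+-congˡ (⊛-distribʳ h (λ i → f 0 *ᴷ tail g i) (tail f ⊛ g) n) ⟩
    f 0 *ᴷ g 0 *ᴷ h (suc n) +ᴷ (((λ i → f 0 *ᴷ tail g i) ⊛ h) n +ᴷ ((tail f ⊛ g) ⊛ h) n)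
      ≈⟨ R.+-congˡ (R.+-cong (scale-⊛ (f 0) (tail g) h n) (⊛-assoc (tail f) g h n)) ⟩
    f 0 *ᴷ g 0 *ᴷ h (suc n) +ᴷ (f 0 *ᴷ (tail g ⊛ h) n +ᴷ (tail f ⊛ (g ⊛ h)) n)
      ≈⟨ solve 5 (λ a b x u v → a :* b :* x :+ (a :* u :+ v) := a :* (b :* x :+ u) :+ v) R.refl _ _ _ _ _ ⟩
    (f ⊛ (g ⊛ h)) (suc n) ∎

  ⊛-identityˡ : ∀ f → const 1# ⊛ f ≗ f
  ⊛-identityˡ f n = R.trans (const-⊛ 1# (const 1#) f (λ _ → R.refl) R.refl n) (R.*-identityˡ _)

  ⊛-zeroˡ : ∀ f → const 0# ⊛ f ≗ const 0#
  ⊛-zeroˡ f n = R.trans (const-⊛ 0# (const 0#) f (λ _ → R.refl) R.refl n) (R.trans (R.zeroˡ _) (0≈ n))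
    where
    0≈ : ∀ n → 0# ≈ᴷ const 0# n
    0≈ zero    = R.refl
    0≈ (suc n) = R.refl

  ⊕-identityˡ : ∀ f → const 0# ⊕ f ≗ f
  ⊕-identityˡ f zero    = R.+-identityˡ _
  ⊕-identityˡ f (suc n) = R.+-identityˡ _

  commutativeSemiring : CommutativeSemiring c ℓ
  commutativeSemiring = record
    { Carrier = Series
    ; _≈_     = _≋_
    ; _+_     = _⊕_
    ; _*_     = _⊛_
    ; 0#      = const 0#
    ; 1#      = const 1#
    ; isCommutativeSemiring = isCommutativeSemiringˡ record
      { +-isCommutativeMonoid = isCommutativeMonoidˡ record
        { isSemigroup = record
          { isMagma = record
            { isEquivalence = ≋-isEquivalence
            ; ∙-cong        = λ p q → pointwise λ n → R.+-cong (coeff p n) (coeff q n)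
            }
          ; assoc = λ f g h → pointwise λ n → R.+-assoc _ _ _
          }
        ; identityˡ = λ f → pointwise (⊕-identityˡ f)
        ; comm      = λ f g → pointwise λ n → R.+-comm _ _
        }
      ; *-isCommutativeMonoid = isCommutativeMonoidˡ record
        { isSemigroup = record
          { isMagma = record
            { isEquivalence = ≋-isEquivalence
            ; ∙-cong        = λ p q → pointwise (⊛-cong (coeff p) (coeff q))
            }
          ; assoc = λ f g h → pointwise (⊛-assoc f g h)
          }
        ; identityˡ = λ f → pointwise (⊛-identityˡ f)
        ; comm      = λ f g → pointwise (⊛-comm f g)
        }
      ; distribʳ = λ h f g → pointwise (⊛-distribʳ h f g)
      ; zeroˡ    = λ f → pointwise (⊛-zeroˡ f)
      }
    }
    where
    open import Algebra.Structures.Biased _≋_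
    ≋-isEquivalence : IsEquivalence _≋_
    ≋-isEquivalence = record
      { refl  = pointwise λ _ → R.refl
      ; sym   = λ p → pointwise λ n → R.sym (coeff p n)
      ; trans = λ p q → pointwise λ n → R.trans (coeff p n) (coeff q n)
      }

-- Arithmetic modulo 5

-- A record for the same reason.
infix 4 _≈₅_
record _≈₅_ (a b : ℕ) : Set where
  constructor mod5
  field residues : a % 5 ≡ b % 5

≡⇒≈₅ : ∀ {a b} → a ≡ b → a ≈₅ b
≡⇒≈₅ refl = mod5 refl

≈₅-isEquivalence : IsEquivalence _≈₅_
≈₅-isEquivalence = record
  { refl  = mod5 refl
  ; sym   = λ { (mod5 p) → mod5 (≡.sym p) }
  ; trans = λ { (mod5 p) (mod5 q) → mod5 (≡.trans p q) }
  }

ℕ/5 : CommutativeSemiring 0ℓ 0ℓ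
ℕ/5 = record
  { Carrier = ℕ
  ; _≈_     = _≈₅_
  ; _+_     = _+_
  ; _*_     = _*_
  ; 0#      = 0
  ; 1#      = 1
  ; isCommutativeSemiring = isCommutativeSemiringˡ record
    { +-isCommutativeMonoid = isCommutativeMonoidˡ record
      { isSemigroup = record
        { isMagma = record
          { isEquivalence = ≈₅-isEquivalence
          ; ∙-cong        = λ { {a} {b} {c} {d} (mod5 p) (mod5 q) → mod5 (≡.trans (%-distribˡ-+ a c 5)
              (≡.trans (≡.cong₂ (λ u v → (u + v) % 5) p q) (≡.sym (%-distribˡ-+ b d 5)))) }
          }
        ; assoc = λ a b c → ≡⇒≈₅ (ℕₚ.+-assoc a b c)
        }
      ; identityˡ = λ a → ≡⇒≈₅ (ℕₚ.+-identityˡ a)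
      ; comm      = λ a b → ≡⇒≈₅ (ℕₚ.+-comm a b)
      }
    ; *-isCommutativeMonoid = isCommutativeMonoidˡ record
      { isSemigroup = record
        { isMagma = record
          { isEquivalence = ≈₅-isEquivalence
          ; ∙-cong        = λ { {a} {b} {c} {d} (mod5 p) (mod5 q) → mod5 (≡.trans (%-distribˡ-* a c 5)
              (≡.trans (≡.cong₂ (λ u v → (u * v) % 5) p q) (≡.sym (%-distribˡ-* b d 5)))) }
          }
        ; assoc = λ a b c → ≡⇒≈₅ (ℕₚ.*-assoc a b c)
        }
      ; identityˡ = λ a → ≡⇒≈₅ (ℕₚ.*-identityˡ a)
      ; comm      = λ a b → ≡⇒≈₅ (ℕₚ.*-comm a b)
      }
    ; distribʳ = λ a b c → ≡⇒≈₅ (ℕₚ.*-distribʳ-+ a b c)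
    ; zeroˡ    = λ a → ≡⇒≈₅ (ℕₚ.*-zeroˡ a)
    }
  }
  where open import Algebra.Structures.Biased _≈₅_

module K = CommutativeSemiring ℕ/5

-- Adding 4c to both sides turns the surplus c into 5c, which is 0 modulo 5.
+₅-cancelʳ : ∀ a b c → a + c ≈₅ b + c → a ≈₅ b
+₅-cancelʳ a b c eq = begin
  a             ≈⟨ [m+kn] a ⟨
  a + c * 5     ≡⟨ ℓ a ⟨
  a + c + 4 * c ≈⟨ K.+-congʳ eq ⟩
  b + c + 4 * c ≡⟨ ℓ b ⟩
  b + c * 5     ≈⟨ [m+kn] b ⟩
  b             ∎
  where
  open SetoidReasoning K.setoid
  open ℕSolver.+-*-Solver
  [m+kn] : ∀ x → x + c * 5 ≈₅ x
  [m+kn] x = mod5 ([m+kn]%n≡m%n x c 5)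
  ℓ : ∀ x → x + c + 4 * c ≡ x + c * 5
  ℓ x = solve 2 (λ x c → x :+ c :+ con 4 :* c := x :+ c :* con 5) refl x c

open PowerSeries ℕ/5
module S = CommutativeSemiring commutativeSemiring
open S using (0#; 1#)
open Exp S.semiring using (^-congˡ) renaming (_^_ to _^ˢ_)

module SS = SemiringSolver commutativeSemiring
module K-Reasoning = SetoidReasoning K.setoid
module S-Reasoning = SetoidReasoning S.setoid

-- Cardinalities of finite predicates

module _ where
  private variable
    A B : Set
    P Q : A → Set
    m n : ℕ

  -- For `P = IsOverpartition m` the middle component is `Enumerates m L`, so the final theorem can
  -- be read off directly.
  Counted : (A → Set) → ℕ → Set
  Counted P n = ∃ λ L → (Unique L × (∀ x → (x ∈ L) ⇔ P x)) × length L ≡ n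

  -- Duplicate-free lists with the same members are permutations of each other. Through this lemma
  -- equivalences of predicates become the numerical recurrences below.
  counted-unique : (∀ x → P x ⇔ Q x) → Counted P m → Counted Q n → m ≡ n
  counted-unique P⇔Q (L , (uL , L⇔P) , refl) (M , (uM , M⇔Q) , refl) =
    ↭-length (∼bag⇒↭ (unique∧set⇒bag uL uM
      (⇔.trans (L⇔P _) (⇔.trans (P⇔Q _) (⇔.sym (M⇔Q _))))))

  counted-resp : (∀ x → P x ⇔ Q x) → Counted P n → Counted Q n
  counted-resp P⇔Q (L , (uL , L⇔P) , len) = L , (uL , λ x → ⇔.trans (L⇔P x) (P⇔Q x)) , len

  counted-∅ : (∀ x → ¬ P x) → Counted P 0
  counted-∅ ¬P = [] , ([] , λ x → mk⇔ (λ ()) (⊥-elim ∘ ¬P x)) , refl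

  counted-singleton : ∀ a → P a → (∀ x → P x → x ≡ a) → Counted P 1
  counted-singleton {P = P} a Pa uniq = a ∷ [] , ([] ∷ [] , λ x → mk⇔ ∈⇒P (here ∘ uniq x)) , refl
    where
    ∈⇒P : ∀ {x} → x ∈ a ∷ [] → P x
    ∈⇒P (here refl) = Pa

  counted-⊎ : (∀ x → P x → ¬ Q x) → Counted P m → Counted Q n → Counted (λ x → P x ⊎ Q x) (m + n)
  counted-⊎ P⇒¬Q (L , (uL , L⇔P) , refl) (M , (uM , M⇔Q) , refl) =
    L ++ M
    , ( Uniqueₚ.++⁺ uL uM (λ (∈L , ∈M) → P⇒¬Q _ (to (L⇔P _) ∈L) (to (M⇔Q _) ∈M))
      , λ x → mk⇔ ([ inj₁ ∘ to (L⇔P x) , inj₂ ∘ to (M⇔Q x) ]′ ∘ ∈-++⁻ L)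
                  [ ∈-++⁺ˡ ∘ from (L⇔P x) , ∈-++⁺ʳ L ∘ from (M⇔Q x) ]′ )
    , length-++ L

  counted-map : ∀ (f : A → B) → (∀ {x y} → f x ≡ f y → x ≡ y) → Counted P n →
                Counted (λ y → ∃ λ x → P x × y ≡ f x) n
  counted-map {P = P} f inj (L , (uL , L⇔P) , refl) =
    map f L
    , ( Uniqueₚ.map⁺ inj uL
      , λ y → mk⇔ (λ y∈ → let x , x∈ , eq = ∈-map⁻ f y∈ in x , to (L⇔P x) x∈ , eq)
                  (λ { (x , Px , refl) → ∈-map⁺ f (from (L⇔P x) Px) }) )
    , length-map f L

  length-cartesianProduct : ∀ (xs : List A) (ys : List B) →
                            length (cartesianProduct xs ys) ≡ length xs * length ys
  length-cartesianProduct []       ys = refl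
  length-cartesianProduct (x ∷ xs) ys = ≡.trans (length-++ (map (x ,_) ys))
    (≡.cong₂ _+_ (length-map (x ,_) ys) (length-cartesianProduct xs ys))

  counted-× : Counted P m → Counted Q n → Counted (λ (x , y) → P x × Q y) (m * n)
  counted-× (L , (uL , L⇔P) , refl) (M , (uM , M⇔Q) , refl) =
    cartesianProduct L M
    , ( Uniqueₚ.cartesianProduct⁺ uL uM
      , λ (x , y) → mk⇔
          (λ xy∈ → let x∈ , y∈ = ∈-cartesianProduct⁻ L M xy∈ in to (L⇔P x) x∈ , to (M⇔Q y) y∈)
          (λ (Px , Qy) → ∈-cartesianProduct⁺ (from (L⇔P x) Px) (from (M⇔Q y) Qy)) )
    , length-cartesianProduct L M

  Conv : (ℕ → A → Set) → (ℕ → B → Set) → ℕ → A × B → Set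
  Conv P Q n (x , y) = ∃₂ λ i j → i + j ≡ n × P i x × Q j y

  -- The first hypothesis says that x determines its degree i. It keeps the cases i = 0 and i > 0,
  -- into which the recursion of `⊛` splits the pairs, disjoint.
  counted-conv : {P : ℕ → A → Set} {Q : ℕ → B → Set} {f g : ℕ → ℕ} →
                 (∀ {i j x} → P i x → P j x → i ≡ j) →
                 (∀ n → Counted (P n) (f n)) → (∀ n → Counted (Q n) (g n)) →
                 ∀ n → Counted (Conv P Q n) ((f ⊛ g) n)
  counted-conv disj cP cQ zero = counted-resp
    (λ x → mk⇔ (λ (p , q) → 0 , 0 , refl , p , q)
               (λ { (zero , zero , _ , p , q) → p , q }))
    (counted-× (cP 0) (cQ 0))
  counted-conv disj cP cQ (suc n) = counted-resp
    (λ x → mk⇔ [ (λ (p , q) → 0 , suc n , refl , p , q)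
               , (λ (i , j , eq , p , q) → suc i , j , ≡.cong suc eq , p , q) ]′
               (λ { (zero  , j , refl , p , q) → inj₁ (p , q)
                  ; (suc i , j , eq , p , q) → inj₂ (i , j , ℕₚ.suc-injective eq , p , q) }))
    (counted-⊎ (λ { _ (p₀ , _) (i , _ , _ , pᵢ , _) → ℕₚ.0≢1+n (disj p₀ pᵢ) })
      (counted-× (cP 0) (cQ (suc n)))
      (counted-conv (λ p q → ℕₚ.suc-injective (disj p q)) (cP ∘ suc) cQ n))

-- Overpartitions by largest part

Overpart : Set
Overpart = List (ℕ × Bool)

Bounded : ℕ → Overpart → Set
Bounded k []            = ⊤
Bounded k ((a , _) ∷ _) = a ≤ k

-- The possible continuations of an overpartition after a part k.
MayFollow : ℕ → Overpart → Set
MayFollow k []            = ⊤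
MayFollow k ((a , b) ∷ _) = a ≤ k × (b ≡ true → a < k)

OverUpTo OverAfter : ℕ → ℕ → Overpart → Set
OverUpTo k m x = IsOverpartition m x × Bounded k x
OverAfter k m x = IsOverpartition m x × MayFollow k x

chain-head-positive : ∀ {a b x} → Chain ((a , b) ∷ x) → 1 ≤ a
chain-head-positive (one 1≤a)      = 1≤a
chain-head-positive (cons c≤a _ c) = ℕₚ.≤-trans (chain-head-positive c) c≤a

chain-∷ : ∀ {a b x} → 1 ≤ a → Chain x → MayFollow a x → Chain ((a , b) ∷ x)
chain-∷ {x = []}    1≤a c mf            = one 1≤a
chain-∷ {x = _ ∷ _} 1≤a c (c≤a , c<a) = cons c≤a c<a c

chain-tail : ∀ {a b x} → Chain ((a , b) ∷ x) → Chain x × MayFollow a x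
chain-tail (one _)          = nil , tt
chain-tail (cons c≤a c<a c) = c , c≤a , c<a

bounded-suc : ∀ {k} x → Bounded k x → Bounded (suc k) x
bounded-suc []      _   = tt
bounded-suc (_ ∷ _) a≤k = ℕₚ.m≤n⇒m≤1+n a≤k

bounded⇒mayFollow : ∀ {k} x → Bounded k x → MayFollow (suc k) x
bounded⇒mayFollow []      _   = tt
bounded⇒mayFollow (_ ∷ _) a≤k = ℕₚ.m≤n⇒m≤1+n a≤k , λ _ → s≤s a≤k

size-bound : ∀ m x → IsOverpartition m x → Bounded m x
size-bound m []            _        = tt
size-bound m ((a , b) ∷ x) (_ , eq) = ℕₚ.≤-trans (ℕₚ.m≤m+n a (size x)) (ℕₚ.≤-reflexive eq)

HeadedBy : Bool → ℕ → ℕ → Overpart → Set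
HeadedBy b k m y = ∃ λ x → OverAfter k m x × y ≡ (k , b) ∷ x

counted-headed : ∀ b k {m n} → Counted (OverAfter k m) n → Counted (HeadedBy b k m) n
counted-headed b k = counted-map ((k , b) ∷_) ∷-injectiveʳ

bounded-¬headed : ∀ {b k m m′} x → OverUpTo k m x → ¬ HeadedBy b (suc k) m′ x
bounded-¬headed _ (_ , 1+k≤k) (_ , _ , refl) = ℕₚ.1+n≰n 1+k≤k

headed-over : ∀ {b k m} x → HeadedBy b (suc k) m x → IsOverpartition (suc k + m) x × Bounded (suc k) x
headed-over _ (_ , ((c , refl) , mf) , refl) = (chain-∷ (s≤s z≤n) c mf , refl) , ℕₚ.≤-refl

over-headed : ∀ {k m b x} → IsOverpartition (suc k + m) ((suc k , b) ∷ x) →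
              HeadedBy b (suc k) m ((suc k , b) ∷ x)
over-headed {k} (c , eq) =
  _ , ((proj₁ (chain-tail c) , ℕₚ.+-cancelˡ-≡ (suc k) _ _ eq) , proj₂ (chain-tail c)) , refl

mayFollow⇒bounded : ∀ {k} x → MayFollow k x → Bounded k x
mayFollow⇒bounded []      _         = tt
mayFollow⇒bounded (_ ∷ _) (a≤k , _) = a≤k

upTo-split : ∀ {k m} x → OverUpTo (suc k) m x →
          OverUpTo k m x ⊎ ∃ λ b → ∃ λ m′ → m ≡ suc k + m′ × HeadedBy b (suc k) m′ x
upTo-split []            (ov , _) = inj₁ (ov , tt)
upTo-split ((a , b) ∷ x) (ov , a≤1+k) with ℕₚ.m≤n⇒m<n∨m≡n a≤1+k
... | inj₁ (s≤s a≤k) = inj₁ (ov , a≤k)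
... | inj₂ refl with ov
...   | c , refl = inj₂ (b , size x , refl , over-headed (c , refl))

-- An entry k following a part k is a repeated occurrence, hence not overlined. This is why `B k m`
-- occurs once in `B-large` but twice in `G-large`.
headed-false : ∀ {b k m} x → MayFollow k x → HeadedBy b k m x → HeadedBy false k m x
headed-false {false} x _        h              = h
headed-false {true}  _ (_ , k<k) (_ , _ , refl) = ⊥-elim (ℕₚ.<-irrefl refl (k<k refl))

module _ (k m : ℕ) (m<1+k : m < suc k) where
  upTo-small : ∀ x → OverUpTo k m x ⇔ OverUpTo (suc k) m x
  upTo-small x = mk⇔ (λ (ov , bd) → ov , bounded-suc x bd) (small x)
    where
    small : ∀ x → OverUpTo (suc k) m x → OverUpTo k m x
    small x ov with upTo-split x ov
    ... | inj₁ p                     = p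
    ... | inj₂ (_ , m′ , refl , _) = ⊥-elim (ℕₚ.<-irrefl refl (ℕₚ.≤-trans m<1+k (ℕₚ.m≤m+n (suc k) m′)))

  after-small : ∀ x → OverUpTo k m x ⇔ OverAfter (suc k) m x
  after-small x = mk⇔ (λ (ov , bd) → ov , bounded⇒mayFollow x bd)
    (λ (ov , mf) → from (upTo-small x) (ov , mayFollow⇒bounded x mf))

module _ (k m : ℕ) where
  upTo-large : ∀ x → (OverUpTo k (suc k + m) x ⊎ HeadedBy false (suc k) m x ⊎ HeadedBy true (suc k) m x)
                  ⇔ OverUpTo (suc k) (suc k + m) x
  upTo-large x = mk⇔
    [ (λ (ov , bd) → ov , bounded-suc x bd) , [ headed-over x , headed-over x ]′ ]′ (large x)
    where
    large : ∀ x → OverUpTo (suc k) (suc k + m) x →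
            OverUpTo k (suc k + m) x ⊎ HeadedBy false (suc k) m x ⊎ HeadedBy true (suc k) m x
    large x ov with upTo-split x ov
    ... | inj₁ p = inj₁ p
    ... | inj₂ (b , m′ , eq , h) with ℕₚ.+-cancelˡ-≡ (suc k) _ _ eq | b
    ...   | refl | false = inj₂ (inj₁ h)
    ...   | refl | true  = inj₂ (inj₂ h)

  after-large : ∀ x → (OverUpTo k (suc k + m) x ⊎ HeadedBy false (suc k) m x)
                  ⇔ OverAfter (suc k) (suc k + m) x
  after-large x = mk⇔
    [ (λ (ov , bd) → ov , bounded⇒mayFollow x bd)
    , (λ { h@(_ , _ , refl) → proj₁ (headed-over x h) , ℕₚ.≤-refl , λ () }) ]′ (large x)
    where
    large : ∀ x → OverAfter (suc k) (suc k + m) x → OverUpTo k (suc k + m) x ⊎ HeadedBy false (suc k) m x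
    large x (ov , mf) with upTo-split x (ov , mayFollow⇒bounded x mf)
    ... | inj₁ p = inj₁ p
    ... | inj₂ (b , m′ , eq , h) with ℕₚ.+-cancelˡ-≡ (suc k) _ _ eq
    ...   | refl = inj₂ (headed-false x mf h)

  counted-upTo-large : ∀ {a b} → Counted (OverUpTo k (suc k + m)) a → Counted (OverAfter (suc k) m) b →
                    Counted (OverUpTo (suc k) (suc k + m)) (a + (b + b))
  counted-upTo-large ca cb = counted-resp upTo-large
    (counted-⊎ (λ x p → [ bounded-¬headed x p , bounded-¬headed x p ]′) ca
      (counted-⊎ (λ { _ (_ , _ , refl) (_ , _ , ()) })
        (counted-headed false (suc k) cb) (counted-headed true (suc k) cb)))

  counted-after-large : ∀ {a b} → Counted (OverUpTo k (suc k + m)) a → Counted (OverAfter (suc k) m) b →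
                    Counted (OverAfter (suc k) (suc k + m)) (a + b)
  counted-after-large ca cb = counted-resp after-large
    (counted-⊎ bounded-¬headed ca (counted-headed false (suc k) cb))

data Compare (k : ℕ) : ℕ → Set where
  below : ∀ {m} → m < k → Compare k m
  above : ∀ m → Compare k (k + m)

compare : ∀ k m → Compare k m
compare k m with k ≤? m
... | no  k≰m = below (ℕₚ.≰⇒> k≰m)
... | yes k≤m with ℕₚ.m≤n⇒∃[o]m+o≡n k≤m
...   | o , refl = above o

counted-upTo-zero : ∀ m → Counted (OverUpTo 0 m) (const 1 m)
counted-upTo-zero zero = counted-singleton [] ((nil , refl) , tt) only-[]
  where
  only-[] : ∀ x → OverUpTo 0 0 x → x ≡ []
  only-[] []            _ = refl
  only-[] ((_ , _) ∷ _) ((c , _) , z≤n) with () ← chain-head-positive c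
counted-upTo-zero (suc m) = counted-∅ none
  where
  none : ∀ x → ¬ OverUpTo 0 (suc m) x
  none []            ((_ , ()) , _)
  none ((_ , _) ∷ _) ((c , _) , z≤n) with () ← chain-head-positive c

-- Abstract, so that the enumerations never unfold.
abstract
  after-exists : ∀ k → (∀ m → ∃ (Counted (OverUpTo k m))) → ∀ m → ∃ (Counted (OverAfter (suc k) m))
  -- Removing a head `suc k` lowers the size by `suc k` at once, so the recursion on m is
  -- well-founded rather than structural.
  after-exists k ca = <-rec _ step
    where
    step : ∀ m → (∀ {i} → i < m → ∃ (Counted (OverAfter (suc k) i))) → ∃ (Counted (OverAfter (suc k) m))
    step m rec with compare (suc k) m
    ... | below m<1+k = _ , counted-resp (after-small k m m<1+k) (proj₂ (ca m))
    ... | above i     = _ , counted-after-large k i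
      (proj₂ (ca (suc k + i))) (proj₂ (rec (s≤s (ℕₚ.m≤n+m i k))))

  upTo-exists : ∀ k m → ∃ (Counted (OverUpTo k m))
  upTo-exists zero    m = _ , counted-upTo-zero m
  upTo-exists (suc k) m with compare (suc k) m
  ... | below m<1+k = _ , counted-resp (upTo-small k m m<1+k) (proj₂ (upTo-exists k m))
  ... | above i     = _ , counted-upTo-large k i
    (proj₂ (upTo-exists k (suc k + i))) (proj₂ (after-exists k (upTo-exists k) i))

-- G k counts the overpartitions with all parts ≤ k, and B k those that may follow a part k + 1;
-- as power series, G k = ∏_{i ≤ k} (1 + q^i)/(1 - q^i) and B k = G k / (1 - q^(k+1)).
G B : ℕ → ℕ → ℕ
G k m = proj₁ (upTo-exists k m)
B k m = proj₁ (after-exists k (upTo-exists k) m)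

counted-G : ∀ k m → Counted (OverUpTo k m) (G k m)
counted-G k m = proj₂ (upTo-exists k m)

counted-B : ∀ k m → Counted (OverAfter (suc k) m) (B k m)
counted-B k m = proj₂ (after-exists k (upTo-exists k) m)

G-zero : ∀ m → G 0 m ≡ const 1 m
G-zero m = counted-unique (λ _ → ⇔.refl) (counted-G 0 m) (counted-upTo-zero m)

module _ (k : ℕ) where
  G-small : ∀ m → m < suc k → G (suc k) m ≡ G k m
  G-small m m<1+k = ≡.sym (counted-unique (upTo-small k m m<1+k) (counted-G k m) (counted-G (suc k) m))

  B-small : ∀ m → m < suc k → B k m ≡ G k m
  B-small m m<1+k = ≡.sym (counted-unique (after-small k m m<1+k) (counted-G k m) (counted-B k m))

  G-large : ∀ m → G (suc k) (suc k + m) ≡ G k (suc k + m) + (B k m + B k m)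
  G-large m = counted-unique (λ _ → ⇔.refl) (counted-G (suc k) (suc k + m))
    (counted-upTo-large k m (counted-G k (suc k + m)) (counted-B k m))

  B-large : ∀ m → B k (suc k + m) ≡ G k (suc k + m) + B k m
  B-large m = counted-unique (λ _ → ⇔.refl) (counted-B k (suc k + m))
    (counted-after-large k m (counted-G k (suc k + m)) (counted-B k m))

-- Gauss' identity

-- The monomial q^k.
X : ℕ → Series
X zero    m       = const 1 m
X (suc k) zero    = 0
X (suc k) (suc m) = X k m

X-below : ∀ k f m → m < k → (X k ⊛ f) m ≡ 0
X-below (suc k) f zero    _           = refl
X-below (suc k) f (suc m) (s≤s m<k) = X-below k f m m<k

X-above : ∀ k f m → (X k ⊛ f) (k + m) ≈₅ f m
X-above zero    f m = ⊛-identityˡ f m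
X-above (suc k) f m = X-above k f m

X-+ : ∀ k l → X k ⊛ X l ≋ X (k + l)
X-+ zero    l = S.*-identityˡ (X l)
X-+ (suc k) l = pointwise λ
  { zero    → K.refl
  ; (suc m) → coeff (X-+ k l) m }

-- With f(0) = 1 the product has at n + 1 the coefficient g(n+1) plus an expression in g(0), ...,
-- g(n), so the coefficients of g are recovered one after another.
⊛-cancelˡ : ∀ f {g h} → f 0 ≡ 1 → f ⊛ g ≋ f ⊛ h → g ≋ h
⊛-cancelˡ f {g} {h} f₀≡1 fg≋fh = pointwise λ n → upTo n n ℕₚ.≤-refl
  where
  open K-Reasoning
  head : ∀ n → f 0 * g n ≈₅ f 0 * h n → g n ≈₅ h n
  head n rewrite f₀≡1 | ℕₚ.*-identityˡ (g n) | ℕₚ.*-identityˡ (h n) = λ eq → eq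
  upTo : ∀ n i → i ≤ n → g i ≈₅ h i
  upTo zero    zero z≤n = head 0 (coeff fg≋fh 0)
  upTo (suc n) i    i≤1+n with ℕₚ.m≤n⇒m<n∨m≡n i≤1+n
  ... | inj₁ (s≤s i≤n) = upTo n i i≤n
  ... | inj₂ refl    = head (suc n) (+₅-cancelʳ _ _ ((tail f ⊛ h) n) (begin
    f 0 * g (suc n) + (tail f ⊛ h) n ≈⟨ K.+-congˡ (⊛-cong≤ n (λ _ _ → K.refl) (upTo n)) ⟨
    (f ⊛ g) (suc n)                  ≈⟨ coeff fg≋fh (suc n) ⟩
    (f ⊛ h) (suc n)                  ∎))

B-eq : ∀ k → B k ≋ G k ⊕ X (suc k) ⊛ B k
B-eq k = pointwise go
  where
  open K-Reasoning
  go : ∀ m → B k m ≈₅ (G k ⊕ X (suc k) ⊛ B k) m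
  go m with compare (suc k) m
  ... | below m<1+k = begin
    B k m                       ≡⟨ B-small k m m<1+k ⟩
    G k m                       ≡⟨ ℕₚ.+-identityʳ _ ⟨
    G k m + 0                   ≡⟨ ≡.cong (λ z → G k m + z) (X-below (suc k) (B k) m m<1+k) ⟨
    G k m + (X (suc k) ⊛ B k) m ∎
  ... | above i = begin
    B k (suc k + i)                                 ≡⟨ B-large k i ⟩
    G k (suc k + i) + B k i                         ≈⟨ K.+-congˡ (X-above (suc k) (B k) i) ⟨
    G k (suc k + i) + (X (suc k) ⊛ B k) (suc k + i) ∎

G-eq : ∀ k → G (suc k) ≋ G k ⊕ (X (suc k) ⊛ B k ⊕ X (suc k) ⊛ B k)
G-eq k = pointwise go
  where
  open K-Reasoning
  go : ∀ m → G (suc k) m ≈₅ (G k ⊕ (X (suc k) ⊛ B k ⊕ X (suc k) ⊛ B k)) m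
  go m with compare (suc k) m
  ... | below m<1+k = begin
    G (suc k) m                                   ≡⟨ G-small k m m<1+k ⟩
    G k m                                         ≡⟨ ℕₚ.+-identityʳ _ ⟨
    G k m + 0
      ≡⟨ ≡.cong (λ z → G k m + (z + z)) (X-below (suc k) (B k) m m<1+k) ⟨
    (G k ⊕ (X (suc k) ⊛ B k ⊕ X (suc k) ⊛ B k)) m ∎
  ... | above i = begin
    G (suc k) (suc k + i)                                   ≡⟨ G-large k i ⟩
    G k (suc k + i) + (B k i + B k i)
      ≈⟨ K.+-congˡ {G k (suc k + i)}
           (K.+-cong (X-above (suc k) (B k) i) (X-above (suc k) (B k) i)) ⟨
    (G k ⊕ (X (suc k) ⊛ B k ⊕ X (suc k) ⊛ B k)) (suc k + i) ∎

G₀≋1 : G 0 ≋ 1#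
G₀≋1 = pointwise λ m → ≡⇒≈₅ (G-zero m)

-- The constant -1.
e : Series
e = const 4

1+e≋0 : 1# ⊕ e ≋ 0#
1+e≋0 = pointwise λ { zero → mod5 refl ; (suc _) → mod5 refl }

-- Stands in for subtraction: an identity involving -1 = e becomes a semiring identity
-- once suitable multiples of 1 + e are added to both sides.
drop-1+e : ∀ f u → f ⊕ (1# ⊕ e) ⊛ u ≋ f
drop-1+e f u = begin
  f ⊕ (1# ⊕ e) ⊛ u ≈⟨ S.+-congˡ (S.*-congʳ 1+e≋0) ⟩
  f ⊕ 0# ⊛ u       ≈⟨ S.+-congˡ (S.zeroˡ u) ⟩
  f ⊕ 0#           ≈⟨ S.+-identityʳ f ⟩
  f                ∎
  where open S-Reasoning

1-Q : ∀ k → G k ≋ (1# ⊕ e ⊛ X (suc k)) ⊛ B k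
1-Q k = begin
  G k                                         ≈⟨ drop-1+e (G k) (Q ⊛ B k) ⟨
  G k ⊕ (1# ⊕ e) ⊛ (Q ⊛ B k)
    ≈⟨ solve 4 (λ g e q b → g :+ (con 1 :+ e) :* (q :* b) := (g :+ q :* b) :+ e :* q :* b)
         S.refl (G k) e Q (B k) ⟩
  (G k ⊕ Q ⊛ B k) ⊕ e ⊛ Q ⊛ B k ≈⟨ S.+-congʳ (B-eq k) ⟨
  B k ⊕ e ⊛ Q ⊛ B k
    ≈⟨ solve 3 (λ e q b → b :+ e :* q :* b := (con 1 :+ e :* q) :* b) S.refl e Q (B k) ⟩
  (1# ⊕ e ⊛ Q) ⊛ B k            ∎
  where
  open SS using (solve; _:=_; _:+_; _:*_; con)
  open S-Reasoning
  Q = X (suc k)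

-- Together with `1-Q` this is the product formula G (k+1) = G k (1 + q^(k+1))/(1 - q^(k+1)), the
-- denominator being absorbed in `B k`.
1+Q : ∀ k → G (suc k) ≋ (1# ⊕ X (suc k)) ⊛ B k
1+Q k = begin
  G (suc k)                 ≈⟨ G-eq k ⟩
  G k ⊕ (Q ⊛ B k ⊕ Q ⊛ B k) ≈⟨ S.+-assoc (G k) (Q ⊛ B k) (Q ⊛ B k) ⟨
  G k ⊕ Q ⊛ B k ⊕ Q ⊛ B k   ≈⟨ S.+-congʳ (B-eq k) ⟨
  B k ⊕ Q ⊛ B k             ≈⟨ solve 2 (λ q b → b :+ q :* b := (con 1 :+ q) :* b) S.refl Q (B k) ⟩
  (1# ⊕ Q) ⊛ B k            ∎
  where
  open SS using (solve; _:=_; _:+_; _:*_; con)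
  open S-Reasoning
  Q = X (suc k)

double : Series → Series
double f = f ⊕ f

⊕-double-cong : ∀ f {g h} → g ≋ h → f ⊕ double g ≋ f ⊕ double h
⊕-double-cong f p = S.+-cong (S.refl {f}) (S.+-cong p p)

-- 1 + 2 Σ_{k=1}^M (-x)^k B (k - 1)
Z : Series → ℕ → Series
Z x zero    = 1#
Z x (suc M) = Z x M ⊕ double ((e ⊛ x) ^ˢ suc M ⊛ B M)

-- The q-difference equation of Z: the sum telescopes since B k = G k + q^(k+1) B k
-- and G (k + 1) = (1 + q^(k+1)) B k.
Z-shift : ∀ x M → (1# ⊕ e ⊛ x) ⊛ Z (x ⊛ X 1) M ≋ (1# ⊕ x) ⊛ Z x M ⊕ double ((e ⊛ x) ^ˢ suc M ⊛ G M)
Z-shift x zero = begin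
  (1# ⊕ e ⊛ x) ⊛ 1#                                ≈⟨ drop-1+e _ x ⟨
  (1# ⊕ e ⊛ x) ⊛ 1# ⊕ (1# ⊕ e) ⊛ x
    ≈⟨ solve 2 (λ e x → (con 1 :+ e :* x) :* con 1 :+ (con 1 :+ e) :* x
         := (con 1 :+ x) :* con 1 :+ (e :* x :* con 1 :* con 1 :+ e :* x :* con 1 :* con 1)) S.refl e x ⟩
  (1# ⊕ x) ⊛ 1# ⊕ double (e ⊛ x ⊛ 1# ⊛ 1#)  ≈⟨ ⊕-double-cong ((1# ⊕ x) ⊛ 1#) G₀ ⟨
  (1# ⊕ x) ⊛ 1# ⊕ double (e ⊛ x ⊛ 1# ⊛ G 0) ∎
  where
  open SS using (solve; _:=_; _:+_; _:*_; con)
  open S-Reasoning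
  G₀ : e ⊛ x ⊛ 1# ⊛ G 0 ≋ e ⊛ x ⊛ 1# ⊛ 1#
  G₀ = S.*-congˡ G₀≋1
Z-shift x (suc M) = begin
  (1# ⊕ e ⊛ x) ⊛ (Z (x ⊛ X 1) M ⊕ double ((e ⊛ (x ⊛ X 1)) ^ˢ suc M ⊛ b))
    ≈⟨ S.*-congˡ (⊕-double-cong (Z (x ⊛ X 1) M) pow) ⟩
  (1# ⊕ e ⊛ x) ⊛ (Z (x ⊛ X 1) M ⊕ double (y ⊛ Q ⊛ b))
    ≈⟨ S.distribˡ _ _ _ ⟩
  (1# ⊕ e ⊛ x) ⊛ Z (x ⊛ X 1) M ⊕ (1# ⊕ e ⊛ x) ⊛ double (y ⊛ Q ⊛ b)
    ≈⟨ S.+-congʳ (Z-shift x M) ⟩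
  (1# ⊕ x) ⊛ Z x M ⊕ double (y ⊛ G M) ⊕ (1# ⊕ e ⊛ x) ⊛ double (y ⊛ Q ⊛ b)
    ≈⟨ S.+-congʳ {(1# ⊕ e ⊛ x) ⊛ double (y ⊛ Q ⊛ b)} (⊕-double-cong ((1# ⊕ x) ⊛ Z x M) Gb) ⟩
  (1# ⊕ x) ⊛ Z x M ⊕ double (y ⊛ ((1# ⊕ e ⊛ Q) ⊛ b)) ⊕ (1# ⊕ e ⊛ x) ⊛ double (y ⊛ Q ⊛ b)
    -- The left side retains 2yqb with its negative, the right side 2xyb with its negative. Each
    -- side receives the cancelling pair of the other, and then both agree as semiring polynomials.
    ≈⟨ drop-1+e _ (double (y ⊛ b ⊛ x)) ⟨
  ((1# ⊕ x) ⊛ Z x M ⊕ double (y ⊛ ((1# ⊕ e ⊛ Q) ⊛ b)) ⊕ (1# ⊕ e ⊛ x) ⊛ double (y ⊛ Q ⊛ b))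
  ⊕ (1# ⊕ e) ⊛ double (y ⊛ b ⊛ x)
    ≈⟨ solve 6 (λ e x z y q b → let 2× t = t :+ t in
         ((con 1 :+ x) :* z :+ 2× (y :* ((con 1 :+ e :* q) :* b)) :+ (con 1 :+ e :* x) :* 2× (y :* q :* b))
         :+ (con 1 :+ e) :* 2× (y :* b :* x)
         := ((con 1 :+ x) :* (z :+ 2× (y :* b)) :+ 2× (e :* x :* y :* ((con 1 :+ q) :* b)))
         :+ (con 1 :+ e) :* 2× (y :* q :* b))
         S.refl e x (Z x M) y Q b ⟩
  ((1# ⊕ x) ⊛ Z x (suc M) ⊕ double (e ⊛ x ⊛ y ⊛ ((1# ⊕ Q) ⊛ b))) ⊕ (1# ⊕ e) ⊛ double (y ⊛ Q ⊛ b)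
    ≈⟨ drop-1+e _ _ ⟩
  (1# ⊕ x) ⊛ Z x (suc M) ⊕ double (e ⊛ x ⊛ y ⊛ ((1# ⊕ Q) ⊛ b))
    ≈⟨ ⊕-double-cong ((1# ⊕ x) ⊛ Z x (suc M)) Gb′ ⟨
  (1# ⊕ x) ⊛ Z x (suc M) ⊕ double ((e ⊛ x) ^ˢ suc (suc M) ⊛ G (suc M)) ∎
  where
  open SS using (solve; _:=_; _:+_; _:*_; con)
  open S-Reasoning
  b = B M
  y = (e ⊛ x) ^ˢ suc M
  Q = X (suc M)
  Gb : y ⊛ G M ≋ y ⊛ ((1# ⊕ e ⊛ Q) ⊛ b)
  Gb = S.*-congˡ (1-Q M)
  Gb′ : e ⊛ x ⊛ y ⊛ G (suc M) ≋ e ⊛ x ⊛ y ⊛ ((1# ⊕ Q) ⊛ b)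
  Gb′ = S.*-congˡ (1+Q M)
  X-^ : ∀ k → X 1 ^ˢ k ≋ X k
  X-^ zero    = S.refl
  X-^ (suc k) = S.trans (S.*-congˡ (X-^ k)) (X-+ 1 k)
  pow : (e ⊛ (x ⊛ X 1)) ^ˢ suc M ⊛ b ≋ y ⊛ Q ⊛ b
  pow = S.*-congʳ (begin
    (e ⊛ (x ⊛ X 1)) ^ˢ suc M ≈⟨ ^-congˡ (suc M) (S.sym (S.*-assoc e x (X 1))) ⟩
    (e ⊛ x ⊛ X 1) ^ˢ suc M   ≈⟨ CommutativeExp.^-distrib-* commutativeSemiring (e ⊛ x) (X 1) (suc M) ⟩
    y ⊛ X 1 ^ˢ suc M         ≈⟨ S.*-congˡ (X-^ (suc M)) ⟩
    y ⊛ Q                    ∎)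

-- 1 + 2 Σ_{k=1}^N (-1)^k q^{k²}
Θ : ℕ → Series
Θ zero    = 1#
Θ (suc N) = Θ N ⊕ double ((e ⊛ X (suc N)) ^ˢ suc N)

-- A Shanks-type finite form of ∏ (1 - q^i)/(1 + q^i) = Σ_{k∈ℤ} (-1)^k q^{k²}.
Z-Θ : ∀ N → Z (X (suc N)) N ≋ G N ⊛ Θ N
Z-Θ zero = S.sym (S.trans (S.*-identityʳ (G 0)) G₀≋1)
Z-Θ (suc N) = ⊛-cancelˡ (1# ⊕ e ⊛ x) refl (begin
  (1# ⊕ e ⊛ x) ⊛ Z (X (suc (suc N))) (suc N)
    ≈⟨ S.*-congˡ (Z-cong (suc N) x⊛q) ⟨
  (1# ⊕ e ⊛ x) ⊛ Z (x ⊛ X 1) (suc N)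
    -- At x = q^(N+1) the shifted argument xq = q^(N+2) is the one wanted for N + 1, while `Z x N`
    -- is covered by the induction hypothesis. The factor 1 - x has constant term 1 and is
    -- cancelled.
    ≈⟨ Z-shift x (suc N) ⟩
  (1# ⊕ x) ⊛ (Z x N ⊕ double (y ⊛ B N)) ⊕ double (e ⊛ x ⊛ y ⊛ G (suc N))
    ≈⟨ ⊕-double-cong ((1# ⊕ x) ⊛ Z x (suc N)) Gb ⟩
  (1# ⊕ x) ⊛ (Z x N ⊕ double (y ⊛ B N)) ⊕ double (e ⊛ x ⊛ y ⊛ ((1# ⊕ x) ⊛ B N))
    ≈⟨ solve 5 (λ e x z y b → let 2× t = t :+ t in
         (con 1 :+ x) :* (z :+ 2× (y :* b)) :+ 2× (e :* x :* y :* ((con 1 :+ x) :* b))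
         := (con 1 :+ x) :* z :+ (con 1 :+ x) :* 2× y :* ((con 1 :+ e :* x) :* b))
         S.refl e x (Z x N) y (B N) ⟩
  (1# ⊕ x) ⊛ Z x N ⊕ (1# ⊕ x) ⊛ double y ⊛ ((1# ⊕ e ⊛ x) ⊛ B N)
    ≈⟨ S.+-cong (S.*-congˡ (S.trans (Z-Θ N) (S.*-congʳ (1-Q N)))) S.refl ⟩
  (1# ⊕ x) ⊛ (((1# ⊕ e ⊛ x) ⊛ B N) ⊛ Θ N) ⊕ (1# ⊕ x) ⊛ double y ⊛ ((1# ⊕ e ⊛ x) ⊛ B N)
    ≈⟨ solve 5 (λ e x z y b → let 2× t = t :+ t in
         (con 1 :+ x) :* (((con 1 :+ e :* x) :* b) :* z) :+ (con 1 :+ x) :* 2× y :* ((con 1 :+ e :* x) :* b)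
         := (con 1 :+ e :* x) :* (((con 1 :+ x) :* b) :* (z :+ 2× y)))
         S.refl e x (Θ N) y (B N) ⟩
  (1# ⊕ e ⊛ x) ⊛ (((1# ⊕ x) ⊛ B N) ⊛ Θ (suc N))
    ≈⟨ S.*-congˡ (S.*-congʳ (1+Q N)) ⟨
  (1# ⊕ e ⊛ x) ⊛ (G (suc N) ⊛ Θ (suc N)) ∎)
  where
  open SS using (solve; _:=_; _:+_; _:*_; con)
  open S-Reasoning
  x = X (suc N)
  y = (e ⊛ x) ^ˢ suc N
  Gb : e ⊛ x ⊛ y ⊛ G (suc N) ≋ e ⊛ x ⊛ y ⊛ ((1# ⊕ x) ⊛ B N)
  Gb = S.*-congˡ (1+Q N)
  x⊛q : x ⊛ X 1 ≋ X (suc (suc N))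
  x⊛q = S.trans (S.*-comm x (X 1)) (X-+ 1 (suc N))
  Z-cong : ∀ M {u v} → u ≋ v → Z u M ≋ Z v M
  Z-cong zero    u≋v = S.refl
  Z-cong (suc M) {u} {v} u≋v = S.+-cong (Z-cong M u≋v) (S.+-cong t t)
    where
    t : (e ⊛ u) ^ˢ suc M ⊛ B M ≋ (e ⊛ v) ^ˢ suc M ⊛ B M
    t = S.*-congʳ (^-congˡ (suc M) (S.*-congˡ u≋v))

-- f(-q), as 4 = -1
twist : Series → Series
twist f m = 4 ^ m * f m

twist-⊛ : ∀ f g n → (twist f ⊛ twist g) n ≈₅ twist (f ⊛ g) n
twist-⊛ f g zero = ≡⇒≈₅ (solve 2 (λ a b → (con 1 :* a) :* (con 1 :* b) := con 1 :* (a :* b)) refl (f 0) (g 0))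
  where open ℕSolver.+-*-Solver
twist-⊛ f g (suc n) = begin
  twist f 0 * twist g (suc n) + (tail (twist f) ⊛ twist g) n
    ≈⟨ K.+-congˡ {twist f 0 * twist g (suc n)}
         (⊛-cong≤ n (λ i _ → ≡⇒≈₅ (ℕₚ.*-assoc 4 (4 ^ i) (f (suc i)))) (λ _ _ → K.refl)) ⟩
  twist f 0 * twist g (suc n) + ((λ i → 4 * twist (tail f) i) ⊛ twist g) n
    ≈⟨ K.+-congˡ {twist f 0 * twist g (suc n)} (scale-⊛ 4 (twist (tail f)) (twist g) n) ⟩
  twist f 0 * twist g (suc n) + 4 * (twist (tail f) ⊛ twist g) n
    ≈⟨ K.+-congˡ {twist f 0 * twist g (suc n)} (K.*-congˡ {4} (twist-⊛ (tail f) g n)) ⟩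
  twist f 0 * twist g (suc n) + 4 * twist (tail f ⊛ g) n
    ≡⟨ solve 5 (λ c p a b x → (con 1 :* a) :* (c :* p :* b) :+ c :* (p :* x)
         := c :* p :* (a :* b :+ x)) refl 4 (4 ^ n) (f 0) (g (suc n)) ((tail f ⊛ g) n) ⟩
  twist (f ⊛ g) (suc n) ∎
  where
  open K-Reasoning
  open ℕSolver.+-*-Solver

-- T N m is the number of integers a with a² = m and ∣a∣ ≤ N.
T : ℕ → Series
T zero    = 1#
T (suc N) = T N ⊕ double (X (suc N * suc N))

-- The numbers k² and k have the same parity. Hence the sign (-1)^k in `Θ` is the sign that `twist`
-- gives to q^(k²).
4^k² : ∀ k → 4 ^ (k * k) ≈₅ 4 ^ k
4^k² zero    = K.refl
4^k² (suc k) = begin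
  4 ^ (suc k * suc k)             ≡⟨ ≡.cong (4 ^_) (square k) ⟩
  4 * 4 ^ (k * k + (k + k))       ≡⟨ ≡.cong (4 *_) (ℕₚ.^-distribˡ-+-* 4 (k * k) (k + k)) ⟩
  4 * (4 ^ (k * k) * 4 ^ (k + k))
    ≈⟨ K.*-congˡ {4} {4 ^ (k * k) * 4 ^ (k + k)} {4 ^ k * 1} (K.*-cong (4^k² k) (even k)) ⟩
  4 * (4 ^ k * 1)                 ≡⟨ ≡.cong (4 *_) (ℕₚ.*-identityʳ (4 ^ k)) ⟩
  4 ^ suc k                       ∎
  where
  open K-Reasoning
  square : ∀ k → suc k * suc k ≡ suc (k * k + (k + k))
  square = solve 1 (λ k → (con 1 :+ k) :* (con 1 :+ k) := con 1 :+ (k :* k :+ (k :+ k))) refl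
    where open ℕSolver.+-*-Solver
  even : ∀ k → 4 ^ (k + k) ≈₅ 1
  even zero    = K.refl
  even (suc k) = begin
    4 * 4 ^ (k + suc k)   ≡⟨ ≡.cong (λ i → 4 * 4 ^ i) (ℕₚ.+-suc k k) ⟩
    4 * (4 * 4 ^ (k + k)) ≈⟨ K.*-congˡ {4} (K.*-congˡ {4} (even k)) ⟩
    16                    ≈⟨ mod5 refl ⟩
    1                     ∎

twist-X : ∀ k m → 4 ^ k * X k m ≈₅ twist (X k) m
twist-X zero    zero    = K.refl
twist-X zero    (suc m) = ≡⇒≈₅ (≡.sym (ℕₚ.*-zeroʳ (4 ^ suc m)))
twist-X (suc k) zero    = ≡⇒≈₅ (ℕₚ.*-zeroʳ (4 ^ suc k))
twist-X (suc k) (suc m) = begin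
  4 * 4 ^ k * X k m   ≡⟨ ℕₚ.*-assoc 4 (4 ^ k) (X k m) ⟩
  4 * (4 ^ k * X k m) ≈⟨ K.*-congˡ {4} (twist-X k m) ⟩
  4 * (4 ^ m * X k m) ≡⟨ ℕₚ.*-assoc 4 (4 ^ m) (X k m) ⟨
  4 * 4 ^ m * X k m   ∎
  where open K-Reasoning

const-* : ∀ a b → const a ⊛ const b ≋ const (a * b)
const-* a b = pointwise λ n → K.trans (const-⊛ a (const a) (const b) (λ _ → K.refl) K.refl n) (scaled n)
  where
  scaled : ∀ n → a * const b n ≈₅ const (a * b) n
  scaled zero    = K.refl
  scaled (suc n) = ≡⇒≈₅ (ℕₚ.*-zeroʳ a)

sign-square : ∀ k → (e ⊛ X k) ^ˢ k ≋ twist (X (k * k))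
sign-square k = begin
  (e ⊛ X k) ^ˢ k            ≈⟨ CommutativeExp.^-distrib-* commutativeSemiring e (X k) k ⟩
  e ^ˢ k ⊛ X k ^ˢ k         ≈⟨ S.*-cong (e-^ k) (X-^ k) ⟩
  const (4 ^ k) ⊛ X (k * k) ≈⟨ pointwise sign ⟩
  twist (X (k * k))         ∎
  where
  open S-Reasoning
  e-^ : ∀ j → e ^ˢ j ≋ const (4 ^ j)
  e-^ zero    = S.refl
  e-^ (suc j) = S.trans (S.*-congˡ (e-^ j)) (const-* 4 (4 ^ j))
  X-^ : ∀ j → X k ^ˢ j ≋ X (j * k)
  X-^ zero    = S.refl
  X-^ (suc j) = S.trans (S.*-congˡ (X-^ j)) (X-+ k (j * k))
  sign : ∀ m → (const (4 ^ k) ⊛ X (k * k)) m ≈₅ twist (X (k * k)) m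
  sign m = K.trans (const-⊛ (4 ^ k) _ _ (λ _ → K.refl) K.refl m)
    (K.trans (K.*-congʳ {X (k * k) m} (K.sym (4^k² k))) (twist-X (k * k) m))

Θ-twist : ∀ N m → Θ N m ≈₅ twist (T N) m
Θ-twist zero zero    = K.refl
Θ-twist zero (suc m) = ≡⇒≈₅ (≡.sym (ℕₚ.*-zeroʳ (4 ^ suc m)))
Θ-twist (suc N) m = begin
  Θ N m + (y + y)   ≈⟨ K.+-cong (Θ-twist N m) (K.+-cong sq sq) ⟩
  twist (T N) m + (twist x m + twist x m)
    ≡⟨ ≡.cong (λ z → twist (T N) m + z) (ℕₚ.*-distribˡ-+ (4 ^ m) (x m) (x m)) ⟨
  twist (T N) m + 4 ^ m * (x m + x m)
    ≡⟨ ℕₚ.*-distribˡ-+ (4 ^ m) (T N m) (x m + x m) ⟨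
  twist (T (suc N)) m ∎
  where
  open K-Reasoning
  x = X (suc N * suc N)
  y = ((e ⊛ X (suc N)) ^ˢ suc N) m
  sq : y ≈₅ twist x m
  sq = coeff (sign-square (suc N)) m

-- Counting squares, and Gauss' identity for the full series

Square : ℕ → ℤ → Set
Square m a = ∣ a ∣ * ∣ a ∣ ≡ m

counted-≡ : ∀ (a : ℤ) k m → Counted (λ x → x ≡ a × k ≡ m) (X k m)
counted-≡ a zero    zero    = counted-singleton a (refl , refl) (λ _ → proj₁)
counted-≡ a zero    (suc m) = counted-∅ λ { _ (_ , ()) }
counted-≡ a (suc k) zero    = counted-∅ λ { _ (_ , ()) }
counted-≡ a (suc k) (suc m) = counted-resp
  (λ _ → mk⇔ (λ (p , q) → p , ≡.cong suc q) (λ (p , q) → p , ℕₚ.suc-injective q)) (counted-≡ a k m)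

counted-T : ∀ N m → Counted (λ a → ∣ a ∣ ≤ N × Square m a) (T N m)
counted-T zero zero = counted-singleton (+ 0) (z≤n , refl)
  λ { (+ zero) _ → refl ; (+ suc _) (() , _) ; -[1+ _ ] (() , _) }
counted-T zero (suc m) = counted-∅
  λ { (+ zero) (_ , ()) ; (+ suc _) (() , _) ; -[1+ _ ] (() , _) }
counted-T (suc N) m = counted-resp
  (λ a → mk⇔ [ (λ (p , q) → ℕₚ.m≤n⇒m≤1+n p , q)
             , [ (λ { (refl , q) → ℕₚ.≤-refl , q }) , (λ { (refl , q) → ℕₚ.≤-refl , q }) ]′ ]′
             (λ (p , q) → split a p q))
  (counted-⊎ (λ { _ (p , _) → [ (λ { (refl , _) → ℕₚ.1+n≰n p }) , (λ { (refl , _) → ℕₚ.1+n≰n p }) ]′ })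
    (counted-T N m)
    (counted-⊎ (λ { _ (refl , _) (() , _) }) (counted-≡ (+ suc N) _ m) (counted-≡ -[1+ N ] _ m)))
  where
  split : ∀ a → ∣ a ∣ ≤ suc N → Square m a → (∣ a ∣ ≤ N × Square m a) ⊎
          ((a ≡ + suc N × suc N * suc N ≡ m) ⊎ (a ≡ -[1+ N ] × suc N * suc N ≡ m))
  split a p q with ℕₚ.m≤n⇒m<n∨m≡n p
  ... | inj₁ (s≤s r) = inj₁ (r , q)
  split (+ _)    p q | inj₂ refl = inj₂ (inj₁ (refl , q))
  split -[1+ _ ] p q | inj₂ refl = inj₂ (inj₂ (refl , q))

n≤n² : ∀ n → n ≤ n * n
n≤n² zero    = z≤n
n≤n² (suc n) = ℕₚ.m≤m+n (suc n) (n * suc n)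

-- From |a| ≤ a² = m ≤ N the bound on |a| in `counted-T` is automatic, so `T N` already has its
-- final coefficients up to N.
counted-square : ∀ {N m} → m ≤ N → Counted (Square m) (T N m)
counted-square {N} {m} m≤N = counted-resp
  (λ a → mk⇔ (λ (_ , q) → q) (λ { refl → ℕₚ.≤-trans (n≤n² ∣ a ∣) m≤N , refl })) (counted-T N m)

-- The coefficients of φ(q) = Σ_{k∈ℤ} q^{k²}, of φ(-q), and of the overpartition generating function.
s θ p̄ : Series
s m = T m m
θ = twist s
p̄ m = G m m

counted-over : ∀ {N m} → m ≤ N → Counted (IsOverpartition m) (G N m)
counted-over {N} {m} m≤N = counted-resp
  (λ x → mk⇔ proj₁ (λ ov → ov , bounded-≤ x (size-bound m x ov))) (counted-G N m)
  where
  bounded-≤ : ∀ x → Bounded m x → Bounded N x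
  bounded-≤ []      _   = _
  bounded-≤ (_ ∷ _) a≤m = ℕₚ.≤-trans a≤m m≤N

-- Every term after the leading 1 contains the factor x = q^k and is invisible below degree k.
Z-low : ∀ k M m → m < k → Z (X k) M m ≈₅ 1# m
Z-low k zero    m m<k = K.refl
Z-low k (suc M) m m<k = begin
  Z (X k) M m + (t + t) ≈⟨ K.+-cong (Z-low k M m m<k) (K.+-cong t≈0 t≈0) ⟩
  1# m + 0              ≡⟨ ℕₚ.+-identityʳ _ ⟩
  1# m                  ∎
  where
  open SS using (solve; _:=_; _:+_; _:*_; con)
  open K-Reasoning
  t = ((e ⊛ X k) ^ˢ suc M ⊛ B M) m
  t≈0 : t ≈₅ 0
  t≈0 = K.trans
    (coeff (solve 4 (λ e x y b → e :* x :* y :* b := x :* (e :* y :* b)) S.refl e (X k) ((e ⊛ X k) ^ˢ M) (B M)) m)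
    (≡⇒≈₅ (X-below k _ m m<k))

-- The coefficient at m sees only indices up to m, where `θ` and `p̄` agree with the truncations
-- `Θ m` and `G m`. The finite identity `Z-Θ` at N = m then leaves a series equal to 1 through
-- degree m.
θ⊛p̄≋1 : θ ⊛ p̄ ≋ 1#
θ⊛p̄≋1 = pointwise λ m → begin
  (θ ⊛ p̄) m        ≈⟨ ⊛-cong≤ m (θ-low m) (p̄-low m) ⟩
  (Θ m ⊛ G m) m     ≈⟨ coeff (S.*-comm (Θ m) (G m)) m ⟩
  (G m ⊛ Θ m) m     ≈⟨ coeff (Z-Θ m) m ⟨
  Z (X (suc m)) m m ≈⟨ Z-low (suc m) m m ℕₚ.≤-refl ⟩
  1# m              ∎
  where
  open K-Reasoning
  θ-low : ∀ m i → i ≤ m → θ i ≈₅ Θ m i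
  θ-low m i i≤m = K.trans
    (≡⇒≈₅ (≡.cong (4 ^ i *_) (counted-unique (λ _ → ⇔.refl) (counted-square ℕₚ.≤-refl) (counted-square i≤m))))
    (K.sym (Θ-twist m i))
  p̄-low : ∀ m i → i ≤ m → p̄ i ≈₅ G m i
  p̄-low m i i≤m = ≡⇒≈₅ (counted-unique (λ _ → ⇔.refl) (counted-over ℕₚ.≤-refl) (counted-over i≤m))

-- Frobenius

-- f(q⁵)
V : Series → Series
V f 0 = f 0
V f 1 = 0
V f 2 = 0
V f 3 = 0
V f 4 = 0
V f (suc (suc (suc (suc (suc n))))) = V (tail f) n

fifth : Series → Series
fifth f = f ⊛ f ⊛ f ⊛ f ⊛ f

fermat : ∀ a → a * a * a * a * a ≈₅ a
fermat a = begin
  a * a * a * a * a ≈⟨ K.*-cong (K.*-cong (K.*-cong (K.*-cong r r) r) r) r ⟩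
  b * b * b * b * b ≈⟨ residue b (m%n<n a 5) ⟩
  b                 ≈⟨ r ⟨
  a                 ∎
  where
  open K-Reasoning
  b = a % 5
  r : a ≈₅ b
  r = mod5 (≡.sym (m%n%n≡m%n a 5))
  residue : ∀ b → b < 5 → b * b * b * b * b ≈₅ b
  residue 0 _ = mod5 refl
  residue 1 _ = mod5 refl
  residue 2 _ = mod5 refl
  residue 3 _ = mod5 refl
  residue 4 _ = mod5 refl
  residue (suc (suc (suc (suc (suc _))))) (s≤s (s≤s (s≤s (s≤s (s≤s ())))))

5×≋0 : ∀ m → m ⊕ m ⊕ m ⊕ m ⊕ m ≋ 0#
5×≋0 m = pointwise λ n → begin
  (m ⊕ m ⊕ m ⊕ m ⊕ m) n ≡⟨ solve 1 (λ m → m :+ m :+ m :+ m :+ m := m :* con 5) refl (m n) ⟩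
  m n * 5               ≈⟨ mod5 (m*n%n≡0 (m n) 5) ⟩
  0                     ≡⟨ 0≡ n ⟩
  0# n                  ∎
  where
  open K-Reasoning
  open ℕSolver.+-*-Solver
  0≡ : ∀ n → 0 ≡ 0# n
  0≡ zero    = refl
  0≡ (suc _) = refl

-- Binomial expansion of (f(0) + q·tail f)⁵: the mixed coefficients 5, 10, 10, 5 vanish modulo 5
-- (`m` is the mixed part divided by 5), and f(0)⁵ = f(0) by Fermat. The resulting recursion is that
-- of `V`.
fifth-tail : ∀ f → fifth f ≋ const (f 0) ⊕ X 5 ⊛ fifth (tail f)
fifth-tail f = begin
  fifth f                                     ≈⟨ S.*-cong (S.*-cong (S.*-cong (S.*-cong f≋ f≋) f≋) f≋) f≋ ⟩
  fifth (a ⊕ x ⊛ t)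
    ≈⟨ solve 3 (λ a x t → let y = x :* t ; 5th z = z :* z :* z :* z :* z
                              m₁ = a :* a :* a :* y :* y ; m₂ = a :* a :* y :* y :* y
                              m = a :* a :* a :* a :* y :+ (m₁ :+ m₁) :+ (m₂ :+ m₂) :+ a :* y :* y :* y :* y
         in 5th (a :+ y) := 5th a :+ 5th x :* 5th t :+ (m :+ m :+ m :+ m :+ m))
         S.refl a x t ⟩
  fifth a ⊕ fifth x ⊛ fifth t ⊕ (m ⊕ m ⊕ m ⊕ m ⊕ m)
    ≈⟨ S.+-cong (S.+-cong a⁵ (S.*-congʳ x⁵)) (5×≋0 m) ⟩
  const (f 0) ⊕ X 5 ⊛ fifth t ⊕ 0# ≈⟨ S.+-identityʳ _ ⟩
  const (f 0) ⊕ X 5 ⊛ fifth t      ∎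
  where
  open SS using (solve; _:=_; _:+_; _:*_; con)
  open S-Reasoning
  a = const (f 0)
  x = X 1
  t = tail f
  y = x ⊛ t
  m = a ⊛ a ⊛ a ⊛ a ⊛ y ⊕ double (a ⊛ a ⊛ a ⊛ y ⊛ y) ⊕ double (a ⊛ a ⊛ y ⊛ y ⊛ y) ⊕ a ⊛ y ⊛ y ⊛ y ⊛ y
  f≋ : f ≋ a ⊕ x ⊛ t
  f≋ = pointwise λ
    { zero    → ≡⇒≈₅ (≡.sym (ℕₚ.+-identityʳ (f 0)))
    ; (suc n) → K.sym (X-above 1 t n) }
  a⁵ : fifth a ≋ a
  a⁵ = S.trans (S.*-congʳ (S.trans (S.*-congʳ (S.trans (S.*-congʳ (const-* _ _)) (const-* _ _))) (const-* _ _)))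
    (S.trans (const-* _ _) (pointwise λ { zero → fermat (f 0) ; (suc _) → K.refl }))
  x⁵ : fifth x ≋ X 5
  x⁵ = S.trans (S.*-congʳ (S.trans (S.*-congʳ (S.trans (S.*-congʳ (X-+ 1 1)) (X-+ 2 1))) (X-+ 3 1))) (X-+ 4 1)

frobenius : ∀ f n → fifth f n ≈₅ V f n
frobenius f n = K.trans (coeff (fifth-tail f) n) (go n)
  where
  go : ∀ n → (const (f 0) ⊕ X 5 ⊛ fifth (tail f)) n ≈₅ V f n
  go 0 = ≡⇒≈₅ (ℕₚ.+-identityʳ (f 0))
  go 1 = K.refl
  go 2 = K.refl
  go 3 = K.refl
  go 4 = K.refl
  go (suc (suc (suc (suc (suc n))))) = K.trans (X-above 5 (fifth (tail f)) n) (frobenius (tail f) n)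

-- A factor in q⁵ passes through the extraction of the exponents divisible by 5, since its other
-- coefficients are zero and drop out by computation.
V-⊛ : ∀ f g n → (V f ⊛ g) (n * 5) ≡ (f ⊛ (λ i → g (i * 5))) n
V-⊛ f g zero    = refl
V-⊛ f g (suc n) = ≡.cong (λ z → f 0 * g (suc n * 5) + z) (V-⊛ (tail f) g n)

-- Sums of four squares and quaternions

-- An `Imaginary` u stands for the right factor 1 + u, real part implicit: all factors used, and
-- their conjugates, have real part 1. The norm of the factor is 1 + `norm′ u`.
Quaternion Imaginary : Set
Quaternion = ℤ × ℤ × ℤ × ℤ
Imaginary  = ℤ × ℤ × ℤ

norm : Quaternion → ℤ
norm (a , b , c , d) = a *ᶻ a +ᶻ (b *ᶻ b +ᶻ (c *ᶻ c +ᶻ d *ᶻ d))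

norm′ : Imaginary → ℤ
norm′ (x , y , z) = x *ᶻ x +ᶻ (y *ᶻ y +ᶻ z *ᶻ z)

conj : Imaginary → Imaginary
conj (x , y , z) = - x , - y , - z

-- Right multiplication by 1 + xi + yj + zk.
infixl 7 _·_
_·_ : Quaternion → Imaginary → Quaternion
(a , b , c , d) · (x , y , z) =
    a -ᶻ x *ᶻ b -ᶻ y *ᶻ c -ᶻ z *ᶻ d
  , b +ᶻ x *ᶻ a +ᶻ z *ᶻ c -ᶻ y *ᶻ d
  , c +ᶻ y *ᶻ a +ᶻ x *ᶻ d -ᶻ z *ᶻ b
  , d +ᶻ z *ᶻ a +ᶻ y *ᶻ b -ᶻ x *ᶻ c

scale : ℤ → Quaternion → Quaternion
scale k (a , b , c , d) = k *ᶻ a , k *ᶻ b , k *ᶻ c , k *ᶻ d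

quaternion-≡ : ∀ {a b c d a′ b′ c′ d′ : ℤ} → a ≡ a′ → b ≡ b′ → c ≡ c′ → d ≡ d′ →
               (a , b , c , d) ≡ (a′ , b′ , c′ , d′)
quaternion-≡ refl refl refl refl = refl

-- Euler's four-square identity.
norm-· : ∀ v u → norm (v · u) ≡ (+ 1 +ᶻ norm′ u) *ᶻ norm v
norm-· (a , b , c , d) (x , y , z) = solve 7 (λ a b c d x y z →
  let sq t = t :* t in
  sq (a :- x :* b :- y :* c :- z :* d) :+ (sq (b :+ x :* a :+ z :* c :- y :* d) :+
  (sq (c :+ y :* a :+ x :* d :- z :* b) :+ sq (d :+ z :* a :+ y :* b :- x :* c)))
  := (con (+ 1) :+ (sq x :+ (sq y :+ sq z))) :* (sq a :+ (sq b :+ (sq c :+ sq d)))) refl a b c d x y z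
  where open ℤSolver.+-*-Solver

scale-· : ∀ k v u → scale k v · u ≡ scale k (v · u)
scale-· k (a , b , c , d) (x , y , z) = quaternion-≡
  (solve 8 (λ k a b c d x y z → k :* a :- x :* (k :* b) :- y :* (k :* c) :- z :* (k :* d)
    := k :* (a :- x :* b :- y :* c :- z :* d)) refl k a b c d x y z)
  (solve 8 (λ k a b c d x y z → k :* b :+ x :* (k :* a) :+ z :* (k :* c) :- y :* (k :* d)
    := k :* (b :+ x :* a :+ z :* c :- y :* d)) refl k a b c d x y z)
  (solve 8 (λ k a b c d x y z → k :* c :+ y :* (k :* a) :+ x :* (k :* d) :- z :* (k :* b)
    := k :* (c :+ y :* a :+ x :* d :- z :* b)) refl k a b c d x y z)
  (solve 8 (λ k a b c d x y z → k :* d :+ z :* (k :* a) :+ y :* (k :* b) :- x :* (k :* c)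
    := k :* (d :+ z :* a :+ y :* b :- x :* c)) refl k a b c d x y z)
  where open ℤSolver.+-*-Solver

-- Associativity and the fact that a quaternion times its conjugate is its norm, checked by
-- coordinates. `P` substitutes `v · u` and `conj u` into one coordinate of the product.
·-conj : ∀ v u → v · u · conj u ≡ scale (+ 1 +ᶻ norm′ u) v
·-conj (a , b , c , d) (x , y , z) = quaternion-≡
  (solve 7 (λ a b c d x y z → P a b c d x y z (λ a b c d x y z →
    a :- x :* b :- y :* c :- z :* d) := N x y z :* a) refl a b c d x y z)
  (solve 7 (λ a b c d x y z → P a b c d x y z (λ a b c d x y z →
    b :+ x :* a :+ z :* c :- y :* d) := N x y z :* b) refl a b c d x y z)
  (solve 7 (λ a b c d x y z → P a b c d x y z (λ a b c d x y z →
    c :+ y :* a :+ x :* d :- z :* b) := N x y z :* c) refl a b c d x y z)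
  (solve 7 (λ a b c d x y z → P a b c d x y z (λ a b c d x y z →
    d :+ z :* a :+ y :* b :- x :* c) := N x y z :* d) refl a b c d x y z)
  where
  open ℤSolver.+-*-Solver
  N : ∀ {n} → Polynomial n → Polynomial n → Polynomial n → Polynomial n
  N x y z = con (+ 1) :+ (x :* x :+ (y :* y :+ z :* z))
  P : ∀ {n} (a b c d x y z : Polynomial n) (f : (a b c d x y z : Polynomial n) → Polynomial n) → Polynomial n
  P a b c d x y z f = f
    (a :- x :* b :- y :* c :- z :* d) (b :+ x :* a :+ z :* c :- y :* d)
    (c :+ y :* a :+ x :* d :- z :* b) (d :+ z :* a :+ y :* b :- x :* c) (:- x) (:- y) (:- z)

·-conj′ : ∀ v u → v · conj u · u ≡ scale (+ 1 +ᶻ norm′ u) v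
·-conj′ v u@(x , y , z) = ≡.trans (≡.cong (v · conj u ·_) (≡.sym conj-conj))
  (≡.trans (·-conj v (conj u)) (≡.cong (λ t → scale (+ 1 +ᶻ t) v) norm-conj))
  where
  open ℤSolver.+-*-Solver
  conj-conj : conj (conj u) ≡ u
  conj-conj rewrite ℤₚ.neg-involutive x | ℤₚ.neg-involutive y | ℤₚ.neg-involutive z = refl
  norm-conj : norm′ (conj u) ≡ norm′ u
  norm-conj = solve 3 (λ x y z → (:- x) :* (:- x) :+ ((:- y) :* (:- y) :+ (:- z) :* (:- z))
    := x :* x :+ (y :* y :+ z :* z)) refl x y z

scale-injective : ∀ {v w} → scale (+ 5) v ≡ scale (+ 5) w → v ≡ w
scale-injective {a , b , c , d} {a′ , b′ , c′ , d′} eq = quaternion-≡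
  (cancel (≡.cong proj₁ eq)) (cancel (≡.cong (proj₁ ∘ proj₂) eq))
  (cancel (≡.cong (proj₁ ∘ proj₂ ∘ proj₂) eq)) (cancel (≡.cong (proj₂ ∘ proj₂ ∘ proj₂) eq))
  where
  cancel : ∀ {x y} → + 5 *ᶻ x ≡ + 5 *ᶻ y → x ≡ y
  cancel = ℤₚ.*-cancelˡ-≡ (+ 5) _ _

FiveDivides : Quaternion → Set
FiveDivides (a , b , c , d) = + 5 ∣ᶻ a × + 5 ∣ᶻ b × + 5 ∣ᶻ c × + 5 ∣ᶻ d

fiveDivides? : Decidable FiveDivides
fiveDivides? (a , b , c , d) = + 5 ∣? a ×-dec + 5 ∣? b ×-dec + 5 ∣? c ×-dec + 5 ∣? d

fiveDivides⇔ : ∀ v → FiveDivides v ⇔ (∃ λ w → v ≡ scale (+ 5) w)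
fiveDivides⇔ (a , b , c , d) = mk⇔
  (λ (divides a′ p , divides b′ q , divides c′ r , divides d′ s) → (a′ , b′ , c′ , d′) ,
    quaternion-≡ (≡.trans p (ℤₚ.*-comm a′ (+ 5))) (≡.trans q (ℤₚ.*-comm b′ (+ 5)))
                 (≡.trans r (ℤₚ.*-comm c′ (+ 5))) (≡.trans s (ℤₚ.*-comm d′ (+ 5))))
  (λ { ((a′ , b′ , c′ , d′) , refl) →
    ∣m⇒∣m*n a′ ∣-refl , ∣m⇒∣m*n b′ ∣-refl , ∣m⇒∣m*n c′ ∣-refl , ∣m⇒∣m*n d′ ∣-refl })

OfNorm : ℕ → Quaternion → Set
OfNorm n v = norm v ≡ + n

module _ {u : Imaginary} (norm-u : norm′ u ≡ + 4) where

  ·-conj-5 : ∀ v → v · u · conj u ≡ scale (+ 5) v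
  ·-conj-5 v = ≡.trans (·-conj v u) (≡.cong (λ t → scale (+ 1 +ᶻ t) v) norm-u)

  conj-·-5 : ∀ v → v · conj u · u ≡ scale (+ 5) v
  conj-·-5 v = ≡.trans (·-conj′ v u) (≡.cong (λ t → scale (+ 1 +ᶻ t) v) norm-u)

  norm-·-5 : ∀ v → norm (v · u) ≡ + 5 *ᶻ norm v
  norm-·-5 v = ≡.trans (norm-· v u) (≡.cong (λ t → (+ 1 +ᶻ t) *ᶻ norm v) norm-u)

  ·-injective : ∀ {v w} → v · u ≡ w · u → v ≡ w
  ·-injective {v} {w} eq = scale-injective
    (≡.trans (≡.sym (·-conj-5 v)) (≡.trans (≡.cong (_· conj u) eq) (·-conj-5 w)))

  -- If v = w · u, then v · conj u = 5w; conversely v · conj u = 5w gives 5v = v · conj u · u = 5(w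
  -- · u). Thus right divisibility by the factor becomes a condition modulo 5, and `w` is determined
  -- by `v`.
  counted-multiples : ∀ {n r} → Counted (OfNorm n) r →
                      Counted (λ v → OfNorm (5 * n) v × FiveDivides (v · conj u)) r
  counted-multiples {n} = counted-resp (λ v → mk⇔ (multiple v) (quotient v)) ∘ counted-map (_· u) ·-injective
    where
    multiple : ∀ v → (∃ λ w → OfNorm n w × v ≡ w · u) → OfNorm (5 * n) v × FiveDivides (v · conj u)
    multiple _ (w , nw , refl) =
      ≡.trans (norm-·-5 w) (≡.trans (≡.cong (+ 5 *ᶻ_) nw) (≡.sym (ℤₚ.pos-* 5 n)))
      , from (fiveDivides⇔ (w · u · conj u)) (w , ·-conj-5 w)
    quotient : ∀ v → OfNorm (5 * n) v × FiveDivides (v · conj u) → ∃ λ w → OfNorm n w × v ≡ w · u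
    quotient v (nv , 5∣) with to (fiveDivides⇔ (v · conj u)) 5∣
    ... | w , eq = w , norm-w , v≡
      where
      v≡ : v ≡ w · u
      v≡ = scale-injective (≡.trans (≡.sym (conj-·-5 v)) (≡.trans (≡.cong (_· u) eq) (scale-· (+ 5) w u)))
      norm-w : norm w ≡ + n
      norm-w = ℤₚ.*-cancelˡ-≡ (+ 5) _ _
        (≡.trans (≡.sym (norm-·-5 w)) (≡.trans (≡.cong norm (≡.sym v≡)) (≡.trans nv (ℤₚ.pos-* 5 n))))

-- 1 ± 2i, 1 ± 2j, 1 ± 2k represent the six classes of norm-5 quaternions up to left units.
units : List Imaginary
units = (+ 2 , + 0 , + 0) ∷ (- + 2 , + 0 , + 0) ∷ (+ 0 , + 2 , + 0) ∷ (+ 0 , - + 2 , + 0)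
      ∷ (+ 0 , + 0 , + 2) ∷ (+ 0 , + 0 , - + 2) ∷ []

norm-units : All (λ u → norm′ u ≡ + 4) units
norm-units = refl ∷ refl ∷ refl ∷ refl ∷ refl ∷ refl ∷ []

-- Right divisors of a quaternion, by residues modulo 5

divisible? : ∀ u → Decidable (λ v → FiveDivides (v · conj u))
divisible? u v = fiveDivides? (v · conj u)

divisors : Quaternion → List Imaginary → ℕ
divisors v us = sum (map (λ u → if does (divisible? u v) then 1 else 0) us)

lift : Fin 5 → ℤ
lift i = + toℕ i

-- A quaternion of norm divisible by 5 has exactly one of the six as right divisor,
-- unless 5 divides it, and then it has all six; this is checked on residues.
divisors-residue : ∀ a b c d → let v = lift a , lift b , lift c , lift d in
                   + 5 ∣ᶻ norm v → divisors v units % 5 ≡ 1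
divisors-residue = from-yes
  (Finₚ.all? λ a → Finₚ.all? λ b → Finₚ.all? λ c → Finₚ.all? λ d →
    let v = lift a , lift b , lift c , lift d in
    (+ 5 ∣? norm v) →-dec (divisors v units % 5 ≟ 1))

-- v + 5w
shift : Quaternion → Quaternion → Quaternion
shift (a , b , c , d) (a′ , b′ , c′ , d′) = a +ᶻ + 5 *ᶻ a′ , b +ᶻ + 5 *ᶻ b′ , c +ᶻ + 5 *ᶻ c′ , d +ᶻ + 5 *ᶻ d′

shift-· : ∀ v w u → shift v w · u ≡ shift (v · u) (w · u)
shift-· (a , b , c , d) (a′ , b′ , c′ , d′) (x , y , z) = quaternion-≡
  (solve 11 (λ a b c d a′ b′ c′ d′ x y z →
    (a :+ 5: a′) :- x :* (b :+ 5: b′) :- y :* (c :+ 5: c′) :- z :* (d :+ 5: d′)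
    := (a :- x :* b :- y :* c :- z :* d) :+ 5: (a′ :- x :* b′ :- y :* c′ :- z :* d′))
    refl a b c d a′ b′ c′ d′ x y z)
  (solve 11 (λ a b c d a′ b′ c′ d′ x y z →
    (b :+ 5: b′) :+ x :* (a :+ 5: a′) :+ z :* (c :+ 5: c′) :- y :* (d :+ 5: d′)
    := (b :+ x :* a :+ z :* c :- y :* d) :+ 5: (b′ :+ x :* a′ :+ z :* c′ :- y :* d′))
    refl a b c d a′ b′ c′ d′ x y z)
  (solve 11 (λ a b c d a′ b′ c′ d′ x y z →
    (c :+ 5: c′) :+ y :* (a :+ 5: a′) :+ x :* (d :+ 5: d′) :- z :* (b :+ 5: b′)
    := (c :+ y :* a :+ x :* d :- z :* b) :+ 5: (c′ :+ y :* a′ :+ x :* d′ :- z :* b′))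
    refl a b c d a′ b′ c′ d′ x y z)
  (solve 11 (λ a b c d a′ b′ c′ d′ x y z →
    (d :+ 5: d′) :+ z :* (a :+ 5: a′) :+ y :* (b :+ 5: b′) :- x :* (c :+ 5: c′)
    := (d :+ z :* a :+ y :* b :- x :* c) :+ 5: (d′ :+ z :* a′ :+ y :* b′ :- x :* c′))
    refl a b c d a′ b′ c′ d′ x y z)
  where
  open ℤSolver.+-*-Solver
  5: : ∀ {n} → Polynomial n → Polynomial n
  5: p = con (+ 5) :* p

∣-shift : ∀ x y → + 5 ∣ᶻ x +ᶻ + 5 *ᶻ y ⇔ + 5 ∣ᶻ x
∣-shift x y = mk⇔ (λ p → ∣m+n∣n⇒∣m p (∣m⇒∣m*n y ∣-refl)) (λ p → ∣m∣n⇒∣m+n p (∣m⇒∣m*n y ∣-refl))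

norm-shift : ∀ v w → + 5 ∣ᶻ norm (shift v w) → + 5 ∣ᶻ norm v
norm-shift v@(a , b , c , d) (a′ , b′ , c′ , d′) p = to (∣-shift (norm v) _) (≡.subst (+ 5 ∣ᶻ_)
  (solve 8 (λ a b c d a′ b′ c′ d′ →
    let sq t = t :* t ; 5: t = con (+ 5) :* t ; r t t′ = con (+ 2) :* t :* t′ :+ con (+ 5) :* t′ :* t′ in
    sq (a :+ 5: a′) :+ (sq (b :+ 5: b′) :+ (sq (c :+ 5: c′) :+ sq (d :+ 5: d′)))
    := (sq a :+ (sq b :+ (sq c :+ sq d))) :+ 5: (r a a′ :+ r b b′ :+ r c c′ :+ r d d′))
  refl a b c d a′ b′ c′ d′) p)
  where open ℤSolver.+-*-Solver

fiveDivides-shift : ∀ v w → FiveDivides (shift v w) ⇔ FiveDivides v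
fiveDivides-shift (a , b , c , d) (a′ , b′ , c′ , d′) = mk⇔
  (λ (p , q , r , s) →
    to (∣-shift a a′) p , to (∣-shift b b′) q , to (∣-shift c c′) r , to (∣-shift d d′) s)
  (λ (p , q , r , s) →
    from (∣-shift a a′) p , from (∣-shift b b′) q , from (∣-shift c c′) r , from (∣-shift d d′) s)

-- Right multiplication is additive, so the divisibility test depends only on v modulo 5. This
-- reduces all quaternions to the 625 residues of `divisors-residue`.
divisors-shift : ∀ v w us → divisors (shift v w) us ≡ divisors v us
divisors-shift v w []       = refl
divisors-shift v w (u ∷ us) = ≡.cong₂ _+_
  (≡.cong (if_then 1 else 0) (does-⇔ same (divisible? u (shift v w)) (divisible? u v)))
  (divisors-shift v w us)
  where
  same : FiveDivides (shift v w · conj u) ⇔ FiveDivides (v · conj u)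
  same = ≡.subst (λ t → FiveDivides t ⇔ FiveDivides (v · conj u)) (≡.sym (shift-· v w (conj u)))
    (fiveDivides-shift (v · conj u) (w · conj u))

residue : ∀ a → ∃ λ i → ∃ λ q → a ≡ lift i +ᶻ + 5 *ᶻ q
residue a = fromℕ< (n%ℕd<d a 5) , a /ℕ 5 , ≡.trans (a≡a%ℕn+[a/ℕn]*n a 5)
  (≡.cong₂ _+ᶻ_ (≡.cong +_ (≡.sym (Finₚ.toℕ-fromℕ< (n%ℕd<d a 5)))) (ℤₚ.*-comm (a /ℕ 5) (+ 5)))

divisors≈1 : ∀ v → + 5 ∣ᶻ norm v → divisors v units ≈₅ 1
divisors≈1 (a , b , c , d) p with residue a | residue b | residue c | residue d
... | i , a′ , refl | j , b′ , refl | k , c′ , refl | l , d′ , refl =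
  K.trans (≡⇒≈₅ (divisors-shift v w units)) (mod5 (divisors-residue i j k l (norm-shift v w p)))
  where
  v w : Quaternion
  v = lift i , lift j , lift k , lift l
  w = a′ , b′ , c′ , d′

-- Double counting of quaternions and their right divisors

incidences : List Imaginary → List Quaternion → ℕ
incidences us L = sum (map (λ u → length (filter (divisible? u) L)) us)

-- The exchange of summation in the double count: `incidences` sums over the factors u, and this
-- recursion takes away one quaternion v together with all its divisors.
incidences-∷ : ∀ us v L → incidences us (v ∷ L) ≡ divisors v us + incidences us L
incidences-∷ []       v L = refl
incidences-∷ (u ∷ us) v L = ≡.trans
  (≡.cong₂ _+_ count-∷ (incidences-∷ us v L))
  (interchange (if does (divisible? u v) then 1 else 0) (length (filter (divisible? u) L)) _ _)
  where
  count-∷ : length (filter (divisible? u) (v ∷ L)) ≡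
            (if does (divisible? u v) then 1 else 0) + length (filter (divisible? u) L)
  count-∷ with does (divisible? u v)
  ... | true  = refl
  ... | false = refl
  interchange : ∀ a b c d → (a + b) + (c + d) ≡ (a + c) + (b + d)
  interchange = CommutativeSemigroupProperties.interchange ℕₚ.+-commutativeSemigroup

sum-constant : ∀ {A : Set} (f : A → ℕ) {c us} → All (λ u → f u ≡ c) us → sum (map f us) ≡ length us * c
sum-constant f []       = refl
sum-constant f (p ∷ ps) = ≡.cong₂ _+_ p (sum-constant f ps)

filter-counted : ∀ {A : Set} {P Q : A → Set} (Q? : Decidable Q) {L} → Unique L → (∀ x → x ∈ L ⇔ P x) →
                 Counted (λ x → P x × Q x) (length (filter Q? L))
filter-counted Q? {L} uL L⇔P =
  filter Q? L
  , ( Uniqueₚ.filter⁺ Q? uL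
    , λ x → mk⇔ (λ x∈ → let x∈L , q = ∈-filter⁻ Q? x∈ in to (L⇔P x) x∈L , q)
                (λ (p , q) → ∈-filter⁺ Q? (from (L⇔P x) p) q) )
  , refl

-- Stated for a variable us, so that the concrete units never unfold.
module _ {us : List Imaginary} (norm-us : All (λ u → norm′ u ≡ + 4) us) (length-us : length us ≈₅ 1)
         (divisors-us : ∀ v → + 5 ∣ᶻ norm v → divisors v us ≈₅ 1) where

  incidences≈length : ∀ L → (∀ v → v ∈ L → + 5 ∣ᶻ norm v) → incidences us L ≈₅ length L
  incidences≈length [] _ = ≡⇒≈₅
    (≡.trans (sum-constant (λ _ → 0) (All.map (λ _ → refl) norm-us)) (ℕₚ.*-zeroʳ (length us)))
  incidences≈length (v ∷ L) p = K.trans (≡⇒≈₅ (incidences-∷ us v L))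
    (K.+-cong (divisors-us v (p v (here refl))) (incidences≈length L (λ w → p w ∘ there)))

  -- The pairs of a v of norm 5n and a right divisor u of v are counted twice. Summing over v gives
  -- r₅ modulo 5; summing over u gives r for each u, and the number of u is 1 modulo 5.
  counted-5n : ∀ {n r r₅} → Counted (OfNorm n) r → Counted (OfNorm (5 * n)) r₅ → r₅ ≈₅ r
  counted-5n {n} {r} cr (L , (uL , L⇔) , refl) = begin
    length L        ≈⟨ incidences≈length L norms ⟨
    incidences us L
      ≡⟨ sum-constant (λ u → length (filter (divisible? u) L)) (All.map (λ {u} → each {u}) norm-us) ⟩
    length us * r   ≈⟨ K.*-congʳ {r} {length us} {1} length-us ⟩
    1 * r           ≡⟨ ℕₚ.*-identityˡ r ⟩
    r               ∎
    where
    open K-Reasoning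
    norms : ∀ v → v ∈ L → + 5 ∣ᶻ norm v
    norms v v∈L = divides (+ n) (≡.trans (to (L⇔ v) v∈L) (≡.trans (ℤₚ.pos-* 5 n) (ℤₚ.*-comm (+ 5) (+ n))))
    Multiple : Imaginary → Quaternion → Set
    Multiple u v = OfNorm (5 * n) v × FiveDivides (v · conj u)
    each : ∀ {u} → norm′ u ≡ + 4 → length (filter (divisible? u) L) ≡ r
    each {u} nu = counted-unique {P = Multiple u} {Q = Multiple u} (λ _ → ⇔.refl)
      (filter-counted {P = OfNorm (5 * n)} {Q = λ v → FiveDivides (v · conj u)} (divisible? u) uL L⇔)
      (counted-multiples {u} nu {n} cr)

r₄ : ℕ → ℕ
r₄ = s ⊛ (s ⊛ (s ⊛ s))

counted-s : ∀ n → Counted (Square n) (s n)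
counted-s n = counted-square ℕₚ.≤-refl

counted-square-conv : {A : Set} {Q : ℕ → A → Set} {g : ℕ → ℕ} → (∀ n → Counted (Q n) (g n)) →
                      ∀ n → Counted (Conv Square Q n) ((s ⊛ g) n)
counted-square-conv {Q = Q} = counted-conv {P = Square} {Q = Q} (λ p q → ≡.trans (≡.sym p) q) counted-s

∣a∣² : ∀ a → + (∣ a ∣ * ∣ a ∣) ≡ a *ᶻ a
∣a∣² (+ n)    = ℤₚ.pos-* n n
∣a∣² -[1+ n ] = refl

counted-r₄ : ∀ n → Counted (OfNorm n) (r₄ n)
counted-r₄ n = counted-resp
  (λ v → mk⇔
    (λ { (_ , _ , refl , refl , _ , _ , refl , refl , _ , _ , refl , refl , refl) → ≡.sym (norm-∣∣ v) })
    (λ nv → _ , _ , ℤₚ.+-injective (≡.trans (norm-∣∣ v) nv) , refl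
          , _ , _ , refl , refl , _ , _ , refl , refl , refl))
  (counted-square-conv (counted-square-conv (counted-square-conv counted-s)) n)
  where
  norm-∣∣ : ∀ v → let (a , b , c , d) = v in
    + (∣ a ∣ * ∣ a ∣ + (∣ b ∣ * ∣ b ∣ + (∣ c ∣ * ∣ c ∣ + ∣ d ∣ * ∣ d ∣))) ≡ norm v
  norm-∣∣ (a , b , c , d) = ≡.cong₂ _+ᶻ_ (∣a∣² a) (≡.cong₂ _+ᶻ_ (∣a∣² b) (≡.cong₂ _+ᶻ_ (∣a∣² c) (∣a∣² d)))

r₄-5n : ∀ n → r₄ (5 * n) ≈₅ r₄ n
r₄-5n n = counted-5n {us = units} norm-units (mod5 refl) divisors≈1
  {n} {r₄ n} {r₄ (5 * n)} (counted-r₄ n) (counted-r₄ (5 * n))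

-- The congruence p̄(5n) ≡ (-1)^n r₃(n)

r₃ θ³ : Series
r₃ = s ⊛ (s ⊛ s)
θ³ = θ ⊛ (θ ⊛ θ)

θ³-twist : ∀ n → θ³ n ≈₅ twist r₃ n
θ³-twist n = K.trans
  (⊛-cong {g = θ ⊛ θ} {g′ = twist (s ⊛ s)} (λ _ → K.refl) (twist-⊛ s s) n) (twist-⊛ s (s ⊛ s) n)

θ⁴-twist : ∀ n → (θ ⊛ θ³) n ≈₅ twist r₄ n
θ⁴-twist n = K.trans
  (⊛-cong {g = θ³} {g′ = twist r₃} (λ _ → K.refl) θ³-twist n) (twist-⊛ s r₃ n)

θ⁵⊛p̄ : fifth θ ⊛ p̄ ≋ θ ⊛ θ³
θ⁵⊛p̄ = begin
  fifth θ ⊛ p̄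
    ≈⟨ solve 2 (λ t p → t :* t :* t :* t :* t :* p := t :* (t :* (t :* t)) :* (t :* p)) S.refl θ p̄ ⟩
  θ ⊛ θ³ ⊛ (θ ⊛ p̄) ≈⟨ S.*-congˡ θ⊛p̄≋1 ⟩
  θ ⊛ θ³ ⊛ 1#       ≈⟨ S.*-identityʳ _ ⟩
  θ ⊛ θ³            ∎
  where
  open S-Reasoning
  open SS using (solve; _:=_; _:*_)

twist-r₄-5n : ∀ n → twist r₄ (n * 5) ≈₅ twist r₄ n
twist-r₄-5n n = K.*-cong sign (K.trans (≡⇒≈₅ (≡.cong r₄ (ℕₚ.*-comm n 5))) (r₄-5n n))
  where
  a = 4 ^ n
  -- Since (4^n)⁵ = 4^n by Fermat, passing from n to 5n does not change the sign.
  sign : 4 ^ (n * 5) ≈₅ a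
  sign = K.trans (≡⇒≈₅ (≡.trans (≡.sym (ℕₚ.^-*-assoc 4 n 5)) (power a))) (fermat a)
    where
    open ℕSolver.+-*-Solver
    power : ∀ a → a ^ 5 ≡ a * a * a * a * a
    power = solve 1 (λ a → a :^ 5 := a :* a :* a :* a :* a) refl

-- The two series are compared after multiplication by `θ`. On the left, `θ` enters the extraction
-- as `V θ`, which is `fifth θ`; the product with `p̄` is then the fourth power of `θ`, whose
-- coefficients at 5n and n agree by `twist-r₄-5n`.
p̄-5n : (λ n → p̄ (n * 5)) ≋ θ³
p̄-5n = ⊛-cancelˡ θ refl (pointwise λ n → begin
  (θ ⊛ (λ i → p̄ (i * 5))) n ≡⟨ V-⊛ θ p̄ n ⟨
  (V θ ⊛ p̄) (n * 5)         ≈⟨ ⊛-cong {g = p̄} (frobenius θ) (λ _ → K.refl) (n * 5) ⟨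
  (fifth θ ⊛ p̄) (n * 5)     ≈⟨ coeff θ⁵⊛p̄ (n * 5) ⟩
  (θ ⊛ θ³) (n * 5)           ≈⟨ θ⁴-twist (n * 5) ⟩
  twist r₄ (n * 5)           ≈⟨ twist-r₄-5n n ⟩
  twist r₄ n                 ≈⟨ θ⁴-twist n ⟨
  (θ ⊛ θ³) n                 ∎)
  where open K-Reasoning

-- Sums of three squares modulo 8, and the conclusion

three-squares≢7 : ∀ x y z → ¬ (x * x + (y * y + z * z)) % 8 ≡ 7
three-squares≢7 x y z eq = residues (fin x) (fin y) (fin z) (≡.trans (≡.sym reduce) eq)
  where
  fin : ℕ → Fin 8
  fin x = fromℕ< (m%n<n x 8)
  sq : Fin 8 → ℕ
  sq i = toℕ i * toℕ i
  residues : ∀ i j k → ¬ (sq i % 8 + (sq j % 8 + sq k % 8) % 8) % 8 ≡ 7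
  residues = from-yes (Finₚ.all? λ i → Finₚ.all? λ j → Finₚ.all? λ k →
    ¬? ((sq i % 8 + (sq j % 8 + sq k % 8) % 8) % 8 ≟ 7))
  square : ∀ x → (x * x) % 8 ≡ sq (fin x) % 8
  square x rewrite Finₚ.toℕ-fromℕ< (m%n<n x 8) = %-distribˡ-* x x 8
  reduce : (x * x + (y * y + z * z)) % 8
         ≡ (sq (fin x) % 8 + (sq (fin y) % 8 + sq (fin z) % 8) % 8) % 8
  reduce = ≡.trans (%-distribˡ-+ (x * x) _ 8) (≡.cong₂ (λ u v → (u + v) % 8) (square x)
    (≡.trans (%-distribˡ-+ (y * y) _ 8) (≡.cong₂ (λ u v → (u + v) % 8) (square y) (square z))))

r₃-8n+7 : ∀ n → r₃ (7 + n * 8) ≡ 0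
r₃-8n+7 n = counted-unique (λ _ → ⇔.refl)
  (counted-square-conv (counted-square-conv counted-s) (7 + n * 8))
  (counted-∅ λ { (a , b , c) (_ , _ , eq , refl , _ , _ , refl , refl , refl) →
    three-squares≢7 (∣ a ∣) (∣ b ∣) (∣ c ∣) (≡.trans (≡.cong (_% 8) eq) ([m+kn]%n≡m%n 7 n 8)) })

5∣p̄ : ∀ n → 5 ∣ p̄ (40 * n + 35)
5∣p̄ n = m%n≡0⇒n∣m _ 5 (_≈₅_.residues (begin
  p̄ (40 * n + 35)     ≡⟨ ≡.cong p̄ (index n) ⟩
  p̄ ((7 + n * 8) * 5) ≈⟨ coeff p̄-5n (7 + n * 8) ⟩
  θ³ (7 + n * 8)       ≈⟨ θ³-twist (7 + n * 8) ⟩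
  twist r₃ (7 + n * 8) ≡⟨ ≡.cong (4 ^ (7 + n * 8) *_) (r₃-8n+7 n) ⟩
  4 ^ (7 + n * 8) * 0  ≡⟨ ℕₚ.*-zeroʳ (4 ^ (7 + n * 8)) ⟩
  0                    ∎))
  where
  open K-Reasoning
  open ℕSolver.+-*-Solver
  index : ∀ n → 40 * n + 35 ≡ (7 + n * 8) * 5
  index = solve 1 (λ n → con 40 :* n :+ con 35 := (con 7 :+ n :* con 8) :* con 5) refl

theorem3p1 : (n : ℕ) →
    ∃ (λ L → Enumerates (40 * n + 35) L)
    × ((L : List (List (ℕ × Bool))) →
    Enumerates (40 * n + 35) L → 5 ∣ length L)
theorem3p1 n = (proj₁ counted , proj₁ (proj₂ counted)) , λ L enum →
  ≡.subst (5 ∣_) (counted-unique (λ _ → ⇔.refl) counted (L , enum , refl)) (5∣p̄ n)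
  where
  counted : Counted (IsOverpartition (40 * n + 35)) (p̄ (40 * n + 35))
  counted = counted-over ℕₚ.≤-refl
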